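{- Let $n\geq 1$. When $W$ is the symmetric group $S_{2n}$, $x_2^{ -1}$ has the following probabilistic interpretation, i.e. it is the distribution of the result of the following shuffle of a deck of $2n$ cards. Step 1: Choose an even number $2j$ between $0$ and $2n$, with the probability of getting $2j$ equal to $\binom{2n}{2j}/2^{2n-1}$. From the stack of $2n$ cards, form a second pile of size $2j$ by removing the top $j$ cards of the stack, and then putting the bottom $j$ cards of the first stack on top of them. Step 2: Now one has a stack of size $2n-2j$ and a stack of size $2j$. Drop cards repeatedly according to the rule that if stacks $1,2$ have sizes $A,B$ at some time, then the next card comes from stack $1$ with probability $\frac{A}{A+B}$ and from stack $2$ with probability $\frac{B}{A+B}$. (Equivalently, choose uniformly at random one of the $\binom{2n}{2j}$ interleavings preserving the relative orders of the cards in each stack.) The description of $x_2^{ -1}$ is the same for the symmetric group $S_{2n+1}$ (deck of $2n+1$ cards), except that in Step 1 the chance of getting $2j$ is $\binom{2n+1}{2j}/2^{2n}$ ($0\le 2j\le 2n$), and at the beginning of Step 2 one has a stack of size $2n+1-2j$ and a stack of size $2j$.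
   Context: Definition of $x_k$ (Cellini). Let $W$ be the Weyl group of an irreducible crystallographic root system of rank $r$ with simple roots $\Pi=\{\alpha_1,\dots,\alpha_r\}$, highest root $\theta$, and coroot lattice $Y$; put $\alpha_0=-\theta$ and $\tilde\Pi=\Pi\cup\{\alpha_0\}$. Let $Cdes(w)$ be the set of elements of $\tilde\Pi$ mapped to negative roots by $w$. For a positive integer $k$ and $I\subseteq\tilde\Pi$, let $a_{k,I}$ be the number of $t\in Y$ such that $\langle\alpha_i,t\rangle=0$ for all $\alpha_i\in I\cap\Pi$, $\langle\alpha_i,t\rangle>0$ for all $\alpha_i\in\Pi-I$, and moreover $\langle\theta,t\rangle=k$ if $\alpha_0\in I$, while $\langle\theta,t\rangle<k$ if $\alpha_0\notin I$. Then $x_k=\sum_{w\in W}\Big(\frac1{k^r}\sum_{I\subseteq\tilde\Pi-Cdes(w)}a_{k,I}\Big)w$, which defines a probability measure on $W$. For $W=S_N$ ($r=N-1$), $W$ acts by $w(e_i)=e_{w(i)}$, $\alpha_i=e_i-e_{i+1}$ ($1\le i\le N-1$), $\theta=e_1-e_N$, and $Y$ is the set of integer vectors in $\mathbb{Z}^N$ with coordinate sum $0$. $x_2^{ -1}$ denotes the image of $x_2$ under the linear map of the group algebra sending each $w$ to $w^{ -1}$. The deck initially has cards labelled $1,\dots,N$ from top to bottom; the shuffled deck is identified with the permutation $\pi$ for which $\pi(i)$ is the label of the card in position $i$ from the top after shuffling. Equivalently, $x_2$ is the distribution of the permutation sending each label to the final position of that card. Cards are dropped from the bottoms of the stacks,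 each dropped card being placed on top of the previously dropped cards. -}

module Defs where

open import Data.Fin using (Fin; zero; suc; fromℕ; inject₁)
open import Data.Fin.Permutation using (Permutation′; _⟨$⟩ʳ_; _⟨$⟩ˡ_; flip)
open import Data.Fin.Properties as Fin using (any?; all?)
open import Data.Fin.Subset using (Subset; _∈_; _∉_; _⊆_; ∁; inside; outside)
open import Data.Fin.Subset.Properties using (_∈?_; _⊆?_)
open import Data.Integer as ℤ using (ℤ; +_; 0ℤ; 1ℤ)
import Data.Integer.Properties as ℤ
open import Data.Integer.Tactic.RingSolver using (solve-∀)
open import Data.List as List
  using (List; []; _∷_; _++_; length; map; filter; concatMap; cartesianProductWith;
         upTo; allFin; take; drop; reverse)
import Data.List.Properties as List
open import Data.List.Membership.Propositional using () renaming (_∈_ to _∈ᴸ_)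
import Data.List.Membership.Propositional.Properties as Mem
open import Data.List.Relation.Unary.Any using (here)
import Data.List.Relation.Unary.All as All
import Data.List.Relation.Unary.AllPairs as AllPairs
open import Data.List.Relation.Unary.Unique.Propositional using (Unique)
import Data.List.Relation.Unary.Unique.Propositional.Properties as Unique
open import Data.Nat as ℕ using (ℕ; zero; suc; _∸_; _^_; ⌊_/2⌋; NonZero)
import Data.Nat.Properties as ℕ
open import Data.Nat.ListAction using (sum)
open import Data.Nat.Combinatorics using (_C_; nCk+nC[k+1]≡[n+1]C[k+1]; nCn≡1)
open import Data.Product using (_×_; _,_; proj₁; proj₂; ∃₂)
open import Data.Rational as ℚ using (ℚ; 0ℚ; 1ℚ)
open import Data.Vec as Vec using (Vec; []; _∷_; lookup; replicate; tabulate; zipWith; _[_]≔_)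
import Data.Vec.Properties as Vec
open import Algebra.Properties.AbelianGroup ℤ.+-0-abelianGroup using (∙-cancelʳ)
open import Function using (_∘_)
open import Relation.Binary.Definitions using (DecidableEquality)
open import Relation.Binary.PropositionalEquality
open import Relation.Nullary using (Dec; does; yes; no; ¬?; contradiction)
open import Relation.Nullary.Decidable using (_×-dec_; _→-dec_)

-- Coordinates of ℤ^N and card labels run from 0 to N - 1 rather than from
-- 1 to N.

sumᵛ : ∀ {N} → Vec ℤ N → ℤ
sumᵛ = Vec.foldr _ ℤ._+_ 0ℤ

⟨_,_⟩ : ∀ {N} → Vec ℤ N → Vec ℤ N → ℤ
⟨ u , v ⟩ = sumᵛ (zipWith ℤ._*_ u v)

infixl 6 _-ᵛ_
_-ᵛ_ : ∀ {N} → Vec ℤ N → Vec ℤ N → Vec ℤ N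
_-ᵛ_ = zipWith ℤ._-_

e : ∀ {N} → Fin N → Vec ℤ N
e {N} i = replicate N 0ℤ [ i ]≔ 1ℤ

-- The linear action with w (e i) = e (w i): coordinate p of w v is
-- coordinate w⁻¹ p of v.
infixr 7 _·_
_·_ : ∀ {N} → Permutation′ N → Vec ℤ N → Vec ℤ N
w · v = tabulate (λ p → lookup v (w ⟨$⟩ˡ p))

θ : ∀ {r} → Vec ℤ (suc r)
θ {r} = e zero -ᵛ e (fromℕ r)

-- Π̃ is indexed by Fin N: index 0 is α₀ = - θ, and indices 1, …, N - 1 are
-- the simple roots.
α : ∀ {N} → Fin N → Vec ℤ N
α zero    = Vec.map (ℤ.-_) θ
α (suc i) = e (inject₁ i) -ᵛ e (suc i)

Negative : ∀ {N} → Vec ℤ N → Set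
Negative {N} v = ∃₂ λ (i j : Fin N) → j Data.Fin.< i × v ≡ e i -ᵛ e j

negative? : ∀ {N} (v : Vec ℤ N) → Dec (Negative v)
negative? v =
  any? λ i → any? λ j → (j Fin.<? i) ×-dec Vec.≡-dec ℤ._≟_ v (e i -ᵛ e j)

Cdes : ∀ {N} → Permutation′ N → Subset N
Cdes w = tabulate (λ i → does (negative? (w · α i)))

-- The condition imposed on t by the element of Π̃ with the given index.
Condition : ∀ {N} → ℕ → Subset N → Vec ℤ N → Fin N → Set
Condition k I t zero      = (zero ∈ I → ⟨ θ , t ⟩ ≡ + k) × (zero ∉ I → ⟨ θ , t ⟩ ℤ.< + k)
Condition k I t i@(suc _) = (i ∈ I → ⟨ α i , t ⟩ ≡ 0ℤ) × (i ∉ I → 0ℤ ℤ.< ⟨ α i , t ⟩)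

-- The first component says that t lies in the coroot lattice Y.
Admissible : ∀ {N} → ℕ → Subset N → Vec ℤ N → Set
Admissible k I t = sumᵛ t ≡ 0ℤ × (∀ i → Condition k I t i)

condition? : ∀ {N} k (I : Subset N) t i → Dec (Condition k I t i)
condition? k I t zero =
  ((zero ∈? I) →-dec (⟨ θ , t ⟩ ℤ.≟ + k)) ×-dec (¬? (zero ∈? I) →-dec (⟨ θ , t ⟩ ℤ.<? + k))
condition? k I t i@(suc _) =
  ((i ∈? I) →-dec (⟨ α i , t ⟩ ℤ.≟ 0ℤ)) ×-dec (¬? (i ∈? I) →-dec (0ℤ ℤ.<? ⟨ α i , t ⟩))

admissible? : ∀ {N} k (I : Subset N) t → Dec (Admissible k I t)
admissible? k I t = (sumᵛ t ℤ.≟ 0ℤ) ×-dec all? (condition? k I t)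

-- The vectors with all coordinates in [-k, k].  All admissible vectors are
-- among them, each listed once: see admissible⇒∈box and box-unique.
range : ℕ → List ℤ
range k = map (λ m → + m ℤ.- + k) (upTo (suc (k ℕ.+ k)))

box : ℕ → ∀ N → List (Vec ℤ N)
box k zero    = [] ∷ []
box k (suc N) = cartesianProductWith _∷_ (range k) (box k N)

a : ∀ {N} → ℕ → Subset N → ℕ
a {N} k I = length (filter (admissible? k I) (box k N))

subsets : ∀ N → List (Subset N)
subsets zero    = [] ∷ []
subsets (suc N) = cartesianProductWith _∷_ (inside ∷ outside ∷ []) (subsets N)

-- An element is given by its coefficients.
GroupAlgebra : ℕ → Set
GroupAlgebra N = Permutation′ N → ℚ

x : ∀ {N} (k : ℕ) .{{_ : NonZero k}} → GroupAlgebra N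
x {N} k w = (+ total) ℚ./ (k ^ (N ∸ 1))
  where
  instance _ = ℕ.m^n≢0 k (N ∸ 1)
  total = sum (map (a k) (filter (_⊆? ∁ (Cdes w)) (subsets N)))

-- The coefficient of w in Σ_v f(v) v⁻¹ is f(w⁻¹).
invert : ∀ {N} → GroupAlgebra N → GroupAlgebra N
invert f w = f (flip w)

-- A list of weighted outcomes; an outcome may occur several times, and its
-- probability is then the sum of its weights.
Dist : Set → Set
Dist A = List (ℚ × A)

return : ∀ {A} → A → Dist A
return v = (1ℚ , v) ∷ []

scale : ∀ {A} → ℚ → Dist A → Dist A
scale p = map (λ (q , v) → p ℚ.* q , v)

infixl 1 _>>=_
_>>=_ : ∀ {A B} → Dist A → (A → Dist B) → Dist B
D >>= f = concatMap (λ (p , v) → scale p (f v)) D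

uniform : ∀ {A} → List A → Dist A
uniform []           = []
uniform vs@(_ ∷ vs′) = map (λ v → (+ 1) ℚ./ suc (length vs′) , v) vs

-- Decks and stacks are listed from top to bottom.
Deck : ℕ → Set
Deck N = List (Fin N)

_≟ᴰ_ : ∀ {N} → DecidableEquality (Deck N)
_≟ᴰ_ = List.≡-dec Fin._≟_

Prob : ∀ {N} → Dist (Deck N) → Deck N → ℚ
Prob D d = List.foldr ℚ._+_ 0ℚ (map proj₁ (filter (λ (_ , d′) → d′ ≟ᴰ d) D))

-- Position i holds the card labelled π i.
deckOf : ∀ {N} → Permutation′ N → Deck N
deckOf π = List.tabulate (π ⟨$⟩ʳ_)

-- For 2 * j ≤ N: the remaining stack, and the second pile.
cut : ∀ {N} → ℕ → Deck N → Deck N × Deck N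
cut {N} j d = drop j (take (N ∸ j) d) , drop (N ∸ j) d ++ take j d

-- The two stacks are listed here from bottom to top, so that the next card
-- to be dropped comes first; the pile of dropped cards is listed from top to
-- bottom.
drops : ∀ {N} → List (Fin N) → List (Fin N) → Deck N → Dist (Deck N)
drops []       []       out = return out
drops (c ∷ cs) []       out = drops cs [] (c ∷ out)
drops []       (d ∷ ds) out = drops [] ds (d ∷ out)
drops (c ∷ cs) (d ∷ ds) out =
  scale ((+ A) ℚ./ (A ℕ.+ B)) (drops cs (d ∷ ds) (c ∷ out)) ++
  scale ((+ B) ℚ./ (A ℕ.+ B)) (drops (c ∷ cs) ds (d ∷ out))
  where
  A = suc (length cs)
  B = suc (length ds)

dropCards : ∀ {N} → Deck N × Deck N → Dist (Deck N)
dropCards (s₁ , s₂) = drops (reverse s₁) (reverse s₂) []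

-- One entry for each interleaving preserving the order in both lists; their
-- number is a binomial coefficient by length-interleavings.
interleavings : ∀ {A : Set} → List A → List A → List (List A)
interleavings []       ds       = ds ∷ []
interleavings (c ∷ cs) []       = (c ∷ cs) ∷ []
interleavings (c ∷ cs) (d ∷ ds) =
  map (c ∷_) (interleavings cs (d ∷ ds)) ++ map (d ∷_) (interleavings (c ∷ cs) ds)

interleaveUniformly : ∀ {N} → Deck N × Deck N → Dist (Deck N)
interleaveUniformly (s₁ , s₂) = uniform (interleavings s₁ s₂)

-- The value of j, for 0 ≤ 2 * j ≤ N, with probability C(N, 2j) / 2^(N-1).
chooseJ : ℕ → Dist ℕ
chooseJ N = map (λ j → (+ (N C (2 ℕ.* j))) ℚ./ (2 ^ (N ∸ 1)) , j) (upTo (suc ⌊ N /2⌋))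
  where instance _ = ℕ.m^n≢0 2 (N ∸ 1)

shuffle : ∀ N → Dist (Deck N)
shuffle N = chooseJ N >>= λ j → dropCards (cut j (allFin N))

length-interleavings : ∀ {A : Set} (cs ds : List A) →
  length (interleavings cs ds) ≡ (length cs ℕ.+ length ds) C length ds
length-interleavings []       ds = sym (nCn≡1 (length ds))
length-interleavings (c ∷ cs) [] = refl
length-interleavings (c ∷ cs) (d ∷ ds) = begin
  length (map (c ∷_) L ++ map (d ∷_) R)          ≡⟨ List.length-++ (map (c ∷_) L) ⟩
  length (map (c ∷_) L) ℕ.+ length (map (d ∷_) R)
    ≡⟨ cong₂ ℕ._+_ (List.length-map (c ∷_) L) (List.length-map (d ∷_) R) ⟩
  length L ℕ.+ length R
    ≡⟨ cong₂ ℕ._+_ (length-interleavings cs (d ∷ ds)) (length-interleavings (c ∷ cs) ds) ⟩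
  (m ℕ.+ suc n) C suc n ℕ.+ suc (m ℕ.+ n) C n   ≡⟨ cong (λ s → (m ℕ.+ suc n) C suc n ℕ.+ s C n) (ℕ.+-suc m n) ⟨
  (m ℕ.+ suc n) C suc n ℕ.+ (m ℕ.+ suc n) C n   ≡⟨ ℕ.+-comm ((m ℕ.+ suc n) C suc n) _ ⟩
  (m ℕ.+ suc n) C n ℕ.+ (m ℕ.+ suc n) C suc n   ≡⟨ nCk+nC[k+1]≡[n+1]C[k+1] (m ℕ.+ suc n) n ⟩
  suc (m ℕ.+ suc n) C suc n                      ∎
  where
  open ≡-Reasoning
  L = interleavings cs (d ∷ ds)
  R = interleavings (c ∷ cs) ds
  m = length cs
  n = length ds

range-unique : ∀ k → Unique (range k)
range-unique k = Unique.map⁺ (λ eq → ℤ.+-injective (∙-cancelʳ (ℤ.- + k) _ _ eq)) (Unique.upTo⁺ _)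

box-unique : ∀ k N → Unique (box k N)
box-unique k zero    = All.[] AllPairs.∷ AllPairs.[]
box-unique k (suc N) =
  Unique.cartesianProductWith⁺ _∷_ Vec.∷-injective (range-unique k) (box-unique k N)

∈range : ∀ k {z} → ℤ.- + k ℤ.≤ z → z ℤ.≤ + k → z ∈ᴸ range k
∈range k {z} lo hi with z ℤ.+ + k in eq | ℤ.+-monoˡ-≤ (+ k) lo
... | + m | _ = subst (_∈ᴸ range k) z≡ (Mem.∈-map⁺ _ (Mem.∈-upTo⁺ (ℕ.s≤s m≤)))
  where
  z≡ : + m ℤ.- + k ≡ z
  z≡ = trans (cong (ℤ._- + k) (sym eq)) (cancel z (+ k))
    where
    cancel : ∀ y c → y ℤ.+ c ℤ.- c ≡ y
    cancel = solve-∀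
  m≤ : m ℕ.≤ k ℕ.+ k
  m≤ = ℤ.drop‿+≤+ (subst (ℤ._≤ + (k ℕ.+ k)) eq (ℤ.+-monoˡ-≤ (+ k) hi))
... | ℤ.-[1+ _ ] | p =
  contradiction (subst (ℤ._≤ _) (ℤ.+-inverseˡ (+ k)) p) λ ()

∈box : ∀ k {N} (t : Vec ℤ N) →
  (∀ i → ℤ.- + k ℤ.≤ lookup t i × lookup t i ℤ.≤ + k) → t ∈ᴸ box k N
∈box k []      _      = here refl
∈box k (z ∷ t) bounds =
  Mem.∈-cartesianProductWith⁺ _∷_
    (∈range k (proj₁ (bounds zero)) (proj₂ (bounds zero))) (∈box k t (bounds ∘ suc))

⟨0,⟩ : ∀ {N} (t : Vec ℤ N) → ⟨ replicate N 0ℤ , t ⟩ ≡ 0ℤ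
⟨0,⟩ []      = refl
⟨0,⟩ (z ∷ t) = trans (ℤ.+-identityˡ _) (⟨0,⟩ t)

⟨e,⟩ : ∀ {N} (i : Fin N) (t : Vec ℤ N) → ⟨ e i , t ⟩ ≡ lookup t i
⟨e,⟩ zero    (z ∷ t) = trans (cong₂ ℤ._+_ (ℤ.*-identityˡ z) (⟨0,⟩ t)) (ℤ.+-identityʳ z)
⟨e,⟩ (suc i) (z ∷ t) = trans (ℤ.+-identityˡ _) (⟨e,⟩ i t)

⟨-,⟩ : ∀ {N} (u v t : Vec ℤ N) → ⟨ u -ᵛ v , t ⟩ ≡ ⟨ u , t ⟩ ℤ.- ⟨ v , t ⟩
⟨-,⟩ []      []      []      = refl
⟨-,⟩ (p ∷ u) (q ∷ v) (z ∷ t) =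
  trans (cong (ℤ._+_ ((p ℤ.- q) ℤ.* z)) (⟨-,⟩ u v t)) (expand p q z _ _)
  where
  expand : ∀ p q z m n →
    (p ℤ.- q) ℤ.* z ℤ.+ (m ℤ.- n) ≡ (p ℤ.* z ℤ.+ m) ℤ.- (q ℤ.* z ℤ.+ n)
  expand = solve-∀

⟨e-e,⟩ : ∀ {N} (i j : Fin N) t → ⟨ e i -ᵛ e j , t ⟩ ≡ lookup t i ℤ.- lookup t j
⟨e-e,⟩ i j t = trans (⟨-,⟩ (e i) (e j) t) (cong₂ ℤ._-_ (⟨e,⟩ i t) (⟨e,⟩ j t))

first-max : ∀ {r} (t : Vec ℤ (suc r)) →
  (∀ i → lookup t (suc i) ℤ.≤ lookup t (inject₁ i)) → ∀ i → lookup t i ℤ.≤ lookup t zero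
first-max t             dec zero    = ℤ.≤-refl
first-max t@(_ ∷ _ ∷ _) dec (suc i) =
  ℤ.≤-trans (first-max (Vec.tail t) (dec ∘ suc) i) (dec zero)

last-min : ∀ {r} (t : Vec ℤ (suc r)) →
  (∀ i → lookup t (suc i) ℤ.≤ lookup t (inject₁ i)) → ∀ i → lookup t (fromℕ r) ℤ.≤ lookup t i
last-min (_ ∷ [])      dec zero    = ℤ.≤-refl
last-min t@(_ ∷ _ ∷ _) dec zero    =
  ℤ.≤-trans (last-min (Vec.tail t) (dec ∘ suc) zero) (dec zero)
last-min t@(_ ∷ _ ∷ _) dec (suc i) = last-min (Vec.tail t) (dec ∘ suc) i

sum-nonpos : ∀ {N} (t : Vec ℤ N) → (∀ i → lookup t i ℤ.≤ 0ℤ) → sumᵛ t ℤ.≤ 0ℤ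
sum-nonpos []      _ = ℤ.≤-refl
sum-nonpos (z ∷ t) p = ℤ.+-mono-≤ (p zero) (sum-nonpos t (p ∘ suc))

sum-nonneg : ∀ {N} (t : Vec ℤ N) → (∀ i → 0ℤ ℤ.≤ lookup t i) → 0ℤ ℤ.≤ sumᵛ t
sum-nonneg []      _ = ℤ.≤-refl
sum-nonneg (z ∷ t) p = ℤ.+-mono-≤ (p zero) (sum-nonneg t (p ∘ suc))

admissible⇒∈box : ∀ {N} k (I : Subset N) t → Admissible k I t → t ∈ᴸ box k N
admissible⇒∈box {zero}  k I []          _           = here refl
admissible⇒∈box {suc r} k I t@(z ∷ t′) (sum≡0 , cond) = ∈box k t λ i →
    ℤ.≤-trans -k≤last (last-min t dec i)
  , ℤ.≤-trans (first-max t dec i) first≤k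
  where
  last = lookup t (fromℕ r)


  dec : ∀ i → lookup t (suc i) ℤ.≤ lookup t (inject₁ i)
  dec i = ℤ.0≤i-j⇒j≤i (subst (0ℤ ℤ.≤_) (⟨e-e,⟩ (inject₁ i) (suc i) t) nonneg)
    where
    nonneg : 0ℤ ℤ.≤ ⟨ α (suc i) , t ⟩
    nonneg with suc i ∈? I
    ... | yes i∈I = ℤ.≤-reflexive (sym (proj₁ (cond (suc i)) i∈I))
    ... | no  i∉I = ℤ.<⇒≤ (proj₂ (cond (suc i)) i∉I)

  spread : z ℤ.- last ℤ.≤ + k
  spread = subst (ℤ._≤ + k) (⟨e-e,⟩ zero (fromℕ r) t) bound
    where
    bound : ⟨ θ , t ⟩ ℤ.≤ + k
    bound with zero ∈? I
    ... | yes 0∈I = ℤ.≤-reflexive (proj₁ (cond zero) 0∈I)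
    ... | no  0∉I = ℤ.<⇒≤ (proj₂ (cond zero) 0∉I)

  last≤0 : last ℤ.≤ 0ℤ
  last≤0 with last ℤ.≤? 0ℤ
  ... | yes p = p
  ... | no ¬p = contradiction sum≡0 (ℤ.<⇒≢ 0<sum ∘ sym)
    where
    pos : ∀ i → 0ℤ ℤ.< lookup t i
    pos i = ℤ.<-≤-trans (ℤ.≰⇒> ¬p) (last-min t dec i)
    0<sum : 0ℤ ℤ.< sumᵛ t
    0<sum = ℤ.+-mono-<-≤ (pos zero) (sum-nonneg t′ (ℤ.<⇒≤ ∘ pos ∘ suc))

  0≤first : 0ℤ ℤ.≤ z
  0≤first with 0ℤ ℤ.≤? z
  ... | yes p = p
  ... | no ¬p = contradiction sum≡0 (ℤ.<⇒≢ sum<0)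
    where
    neg : ∀ i → lookup t i ℤ.< 0ℤ
    neg i = ℤ.≤-<-trans (first-max t dec i) (ℤ.≰⇒> ¬p)
    sum<0 : sumᵛ t ℤ.< 0ℤ
    sum<0 = ℤ.+-mono-<-≤ (neg zero) (sum-nonpos t′ (ℤ.<⇒≤ ∘ neg ∘ suc))

  first≤k : z ℤ.≤ + k
  first≤k = begin
    z               ≡⟨ ℤ.+-identityʳ z ⟨
    z ℤ.+ 0ℤ        ≤⟨ ℤ.+-monoʳ-≤ z (ℤ.neg-mono-≤ last≤0) ⟩
    z ℤ.- last      ≤⟨ spread ⟩
    + k             ∎
    where open ℤ.≤-Reasoning

  -k≤last : ℤ.- + k ℤ.≤ last
  -k≤last = begin
    ℤ.- + k            ≤⟨ ℤ.neg-mono-≤ spread ⟩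
    ℤ.- (z ℤ.- last)   ≡⟨ swap z last ⟩
    last ℤ.- z         ≤⟨ ℤ.+-monoʳ-≤ last (ℤ.neg-mono-≤ 0≤first) ⟩
    last ℤ.+ 0ℤ        ≡⟨ ℤ.+-identityʳ last ⟩
    last               ∎
    where
    open ℤ.≤-Reasoning
    swap : ∀ u v → ℤ.- (u ℤ.- v) ≡ v ℤ.- u
    swap = solve-∀

{-# OPTIONS --safe #-}
module Submission where

-- By the definition of a, the coefficient of w⁻¹ in x₂ is 2^(1-N) times the
-- number of weakly decreasing t ∈ Y with ⟨θ,t⟩ ≤ 2 whose defining inequalities
-- are strict along Cdes(w⁻¹).  Since the coordinates of t sum to 0, these
-- conditions force t = (1,…,1,0,…,0,-1,…,-1) with j entries 1 and j entries -1,
-- 2j ≤ N, and strictness then says that w⁻¹ is increasing on the labels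
-- j+1,…,N-j and on N-j+1,…,N,1,…,j, i.e. that the deck of w is an interleaving
-- of the two stacks of the j-th cut.  The shuffle produces each of the C(N,2j)
-- interleavings with probability 1 / C(N,2j), which cancels the weight
-- C(N,2j) / 2^(N-1) of j.

open import Data.Nat using (ℕ; suc; _*_; _≤_)
open import Data.List using (List; allFin)
open import Data.Fin.Permutation using (Permutation′)
open import Data.Product using (_×_)
open import Relation.Binary.PropositionalEquality using (_≡_)
open import Defs

open import Data.Bool using (true; false; if_then_else_)
open import Data.Fin as Fin using (Fin; zero; suc; toℕ; fromℕ; fromℕ<; inject₁)
open import Data.Fin.Permutation using (_⟨$⟩ʳ_; _⟨$⟩ˡ_; inverseˡ; inverseʳ; flip)
import Data.Fin.Properties as Fin
open import Data.Fin.Subset using (Subset; _⊆_; ∁; inside; outside) renaming (_∈_ to _∈ₛ_)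
import Data.Fin.Subset.Properties as Subset
open import Data.Integer as ℤ using (ℤ; +_; -[1+_]; 0ℤ; 1ℤ)
import Data.Integer.Properties as ℤ
import Data.Integer.Tactic.RingSolver as ℤ-Solver
open import Data.List as List
  using ([]; _∷_; _++_; concat; drop; filter; head; last; length; map; merge; reverse; reverseAcc;
         take; upTo)
import Data.List.Membership.DecPropositional as DecMembership
open import Data.List.Membership.Propositional using (_∈_; _∉_)
open import Data.List.Membership.Propositional.Properties
  using (∈-map⁺; ∈-map⁻; ∈-++⁺ˡ; ∈-++⁺ʳ; ∈-++⁻; ∈-allFin; ∈-filter⁺; ∈-filter⁻; ∈-concat⁺′;
         ∈-concat⁻′; ∈-cartesianProductWith⁺; ∈-upTo⁺; ∈-upTo⁻)
open import Data.List.Membership.Propositional.Properties.WithK using (unique∧set⇒bag)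
import Data.List.Properties as List
open import Data.List.Relation.Binary.BagAndSetEquality using (∼bag⇒↭)
open import Data.List.Relation.Binary.Disjoint.Propositional using (Disjoint)
open import Data.List.Relation.Binary.Permutation.Propositional
  using (_↭_; module PermutationReasoning; ↭-sym; ↭-trans; ↭⇒↭ₛ)
import Data.List.Relation.Binary.Permutation.Propositional.Properties as Perm
open import Data.List.Relation.Binary.Pointwise using (Pointwise-≡⇒≡)
import Data.List.Relation.Ternary.Interleaving as Interleaving
import Data.List.Relation.Ternary.Interleaving.Properties as Interleaving
open import Data.List.Relation.Ternary.Interleaving.Propositional
  using (Interleaving; []; consˡ; consʳ; toPermutation)
open import Data.List.Relation.Unary.All as All using (All; []; _∷_)
import Data.List.Relation.Unary.All.Properties as All
open import Data.List.Relation.Unary.AllPairs as AllPairs using (AllPairs; []; _∷_)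
import Data.List.Relation.Unary.AllPairs.Properties as AllPairs
open import Data.List.Relation.Unary.Any using (here; there)
open import Data.List.Relation.Unary.Linked using (Linked; []; [-]; _∷_)
import Data.List.Relation.Unary.Linked.Properties as Linked
import Data.List.Relation.Unary.Sorted.TotalOrder.Properties as Sorted
open import Data.List.Relation.Unary.Unique.Propositional using (Unique)
import Data.List.Relation.Unary.Unique.Propositional.Properties as Unique
open import Data.Maybe as Maybe using (just)
open import Data.Maybe.Relation.Binary.Connected
  using (Connected; just; nothing; just-nothing; nothing-just)
open import Data.Nat as ℕ using (zero; _+_; _∸_; _^_; _!; ⌊_/2⌋; NonZero; z≤n; s≤s)
open import Data.Nat.Combinatorics using (_C_)
open import Data.Nat.ListAction using (sum)
import Data.Nat.Properties as ℕ
import Data.Nat.Tactic.RingSolver as ℕ-Solver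
open import Data.Product using (_,_; proj₁; proj₂; ∃)
open import Data.Rational as ℚ using (ℚ; 1ℚ; toℚᵘ)
import Data.Rational.Properties as ℚ
import Data.Rational.Unnormalised as ℚᵘ
import Data.Rational.Unnormalised.Properties as ℚᵘ
open import Data.Sum using (inj₁; inj₂)
open import Data.Vec as Vec using (Vec; []; _∷_; lookup)
import Data.Vec.Properties as Vec
open import Function using (_∘_; _on_; id; mk⇔)
open import Relation.Binary.Definitions using (tri<; tri≈; tri>)
open import Relation.Binary.PropositionalEquality hiding ([_])
open import Relation.Nullary using (¬_; does; yes; no; contradiction)
open import Relation.Nullary.Decidable using (dec-true)
open import Relation.Unary using (Decidable)

-- Probabilities

-- The set `I` can be recovered from `t`: it records the walls of the dilated alcove on which `t`
-- lies. Hence no lattice point is counted for two different `I`, and for fixed `w` both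
-- coefficients become 2^(1-N) times the length of a duplicate-free list: the lattice points, and
-- the admissible `j`. The shape of the second pile comes from the affine root. It compares labels 1
-- and N, and its wall contains the point whenever j ≥ 1; so label N has to lie above label 1, which
-- glues the bottom block in front of the top block. For j ≥ 1 the simple walls that miss the point
-- are the places where the deck is cut; they merge into one wall when 2j = N. The inverse appears
-- because descents of w⁻¹ compare the positions of neighbouring labels. Probabilities are kept
-- multiplied by the number of interleavings, so that the rational arithmetic reduces to identities
-- between natural numbers.

ι : ℕ → ℚ
ι n = + n ℚ./ 1

-- `ℚ._/_` divides out the gcd, so equations between quotients are checked on unnormalised
-- representatives, where they are cross-multiplications.
toℚᵘ-/ : ∀ z n .{{_ : NonZero n}} → toℚᵘ (z ℚ./ n) ℚᵘ.≃ z ℚᵘ./ n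
toℚᵘ-/ z (suc n) = ℚ.toℚᵘ-fromℚᵘ (ℚᵘ.mkℚᵘ z n)

ι-+ : ∀ m n → ι m ℚ.+ ι n ≡ ι (m + n)
ι-+ m n = ℚ.toℚᵘ-injective (begin
  toℚᵘ (ι m ℚ.+ ι n)             ≈⟨ ℚ.toℚᵘ-homo-+ (ι m) (ι n) ⟩
  toℚᵘ (ι m) ℚᵘ.+ toℚᵘ (ι n)     ≈⟨ ℚᵘ.+-cong (toℚᵘ-/ (+ m) 1) (toℚᵘ-/ (+ n) 1) ⟩
  (+ m ℚᵘ./ 1) ℚᵘ.+ (+ n ℚᵘ./ 1)
    ≈⟨ ℚᵘ.*≡* (cong (ℤ._* + 1) (cong₂ ℤ._+_ (ℤ.*-identityʳ (+ m)) (ℤ.*-identityʳ (+ n)))) ⟩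
  + (m + n) ℚᵘ./ 1               ≈⟨ toℚᵘ-/ (+ (m + n)) 1 ⟨
  toℚᵘ (ι (m + n))               ∎)
  where open ℚᵘ.≃-Reasoning

-- In `Prob-drops`, `m` is the number of all interleavings and `l` the number of those in one
-- branch; the lemma then turns a branch probability into a count.
/-*-ι : ∀ a m l n .{{_ : NonZero n}} → a * m ≡ l * n → (+ a ℚ./ n) ℚ.* ι m ≡ ι l
/-*-ι a m l n@(suc _) am≡ln = ℚ.toℚᵘ-injective (begin
  toℚᵘ ((+ a ℚ./ n) ℚ.* ι m)       ≈⟨ ℚ.toℚᵘ-homo-* (+ a ℚ./ n) (ι m) ⟩
  toℚᵘ (+ a ℚ./ n) ℚᵘ.* toℚᵘ (ι m) ≈⟨ ℚᵘ.*-cong (toℚᵘ-/ (+ a) n) (toℚᵘ-/ (+ m) 1) ⟩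
  (+ a ℚᵘ./ n) ℚᵘ.* (+ m ℚᵘ./ 1)   ≈⟨ ℚᵘ.*≡* cross ⟩
  + l ℚᵘ./ 1                       ≈⟨ toℚᵘ-/ (+ l) 1 ⟨
  toℚᵘ (ι l)                       ∎)
  where
  open ℚᵘ.≃-Reasoning
  cross : (+ a ℤ.* + m) ℤ.* + 1 ≡ + l ℤ.* + (n * 1)
  cross = trans (ℤ.*-identityʳ _) (trans (sym (ℤ.pos-* a m))
    (trans (cong +_ (trans am≡ln (cong (l ℕ.*_) (sym (ℕ.*-identityʳ n))))) (ℤ.pos-* l (n * 1))))

1/-*-ι : ∀ n .{{_ : NonZero n}} → (+ 1 ℚ./ n) ℚ.* ι n ≡ 1ℚ
1/-*-ι n = /-*-ι 1 n 1 n refl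

*-ι-cancel : ∀ n .{{_ : NonZero n}} {p q} → p ℚ.* ι n ≡ q ℚ.* ι n → p ≡ q
*-ι-cancel n {p} {q} eq = trans (undo p) (trans (cong (ℚ._* (+ 1 ℚ./ n)) eq) (sym (undo q)))
  where
  undo : ∀ p → p ≡ p ℚ.* ι n ℚ.* (+ 1 ℚ./ n)
  undo p = begin
    p                           ≡⟨ ℚ.*-identityʳ p ⟨
    p ℚ.* 1ℚ                    ≡⟨ cong (p ℚ.*_) (1/-*-ι n) ⟨
    p ℚ.* ((+ 1 ℚ./ n) ℚ.* ι n) ≡⟨ cong (p ℚ.*_) (ℚ.*-comm (+ 1 ℚ./ n) (ι n)) ⟩
    p ℚ.* (ι n ℚ.* (+ 1 ℚ./ n)) ≡⟨ ℚ.*-assoc p _ _ ⟨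
    p ℚ.* ι n ℚ.* (+ 1 ℚ./ n)   ∎
    where open ≡-Reasoning

/≡ι*1/ : ∀ a n .{{_ : NonZero n}} → + a ℚ./ n ≡ ι a ℚ.* (+ 1 ℚ./ n)
/≡ι*1/ a n = *-ι-cancel n (begin
  (+ a ℚ./ n) ℚ.* ι n           ≡⟨ /-*-ι a n a n refl ⟩
  ι a                           ≡⟨ ℚ.*-identityʳ (ι a) ⟨
  ι a ℚ.* 1ℚ                    ≡⟨ cong (ι a ℚ.*_) (1/-*-ι n) ⟨
  ι a ℚ.* ((+ 1 ℚ./ n) ℚ.* ι n) ≡⟨ ℚ.*-assoc (ι a) _ _ ⟨
  ι a ℚ.* (+ 1 ℚ./ n) ℚ.* ι n   ∎)
  where open ≡-Reasoning

module _ {N : ℕ} where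

  count : Deck N → List (Deck N) → ℕ
  count d ds = length (filter (_≟ᴰ d) ds)

  -- Turning the test of the filter into a factor 0 or 1 makes `Prob` visibly linear in the weights.
  Prob-∷ : ∀ p v (D : Dist (Deck N)) d → Prob ((p , v) ∷ D) d ≡ p ℚ.* ι (count d (v ∷ [])) ℚ.+ Prob D d
  Prob-∷ p v D d with does (v ≟ᴰ d)
  ... | true  = cong (ℚ._+ Prob D d) (sym (ℚ.*-identityʳ p))
  ... | false = sym (trans (cong (ℚ._+ Prob D d) (ℚ.*-zeroʳ p)) (ℚ.+-identityˡ _))

  Prob-++ : ∀ (D E : Dist (Deck N)) d → Prob (D ++ E) d ≡ Prob D d ℚ.+ Prob E d
  Prob-++ []            E d = sym (ℚ.+-identityˡ _)
  Prob-++ ((p , v) ∷ D) E d = begin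
    Prob ((p , v) ∷ D ++ E) d         ≡⟨ Prob-∷ p v (D ++ E) d ⟩
    m ℚ.+ Prob (D ++ E) d             ≡⟨ cong (m ℚ.+_) (Prob-++ D E d) ⟩
    m ℚ.+ (Prob D d ℚ.+ Prob E d)     ≡⟨ ℚ.+-assoc m _ _ ⟨
    m ℚ.+ Prob D d ℚ.+ Prob E d       ≡⟨ cong (ℚ._+ Prob E d) (Prob-∷ p v D d) ⟨
    Prob ((p , v) ∷ D) d ℚ.+ Prob E d ∎
    where
    open ≡-Reasoning
    m = p ℚ.* ι (count d (v ∷ []))

  Prob-scale : ∀ p (D : Dist (Deck N)) d → Prob (scale p D) d ≡ p ℚ.* Prob D d
  Prob-scale p []            d = sym (ℚ.*-zeroʳ p)
  Prob-scale p ((q , v) ∷ D) d = begin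
    Prob ((p ℚ.* q , v) ∷ scale p D) d   ≡⟨ Prob-∷ (p ℚ.* q) v (scale p D) d ⟩
    p ℚ.* q ℚ.* c ℚ.+ Prob (scale p D) d ≡⟨ cong₂ ℚ._+_ (ℚ.*-assoc p q c) (Prob-scale p D d) ⟩
    p ℚ.* (q ℚ.* c) ℚ.+ p ℚ.* Prob D d   ≡⟨ ℚ.*-distribˡ-+ p _ _ ⟨
    p ℚ.* (q ℚ.* c ℚ.+ Prob D d)         ≡⟨ cong (p ℚ.*_) (Prob-∷ q v D d) ⟨
    p ℚ.* Prob ((q , v) ∷ D) d           ∎
    where
    open ≡-Reasoning
    c = ι (count d (v ∷ []))

  count-++ : ∀ d (xs ys : List (Deck N)) → count d (xs ++ ys) ≡ count d xs + count d ys
  count-++ d xs ys = trans (cong length (List.filter-++ (_≟ᴰ d) xs ys)) (List.length-++ (filter (_≟ᴰ d) xs))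

  Prob-const : ∀ q (vs : List (Deck N)) d → Prob (map (q ,_) vs) d ≡ q ℚ.* ι (count d vs)
  Prob-const q []       d = sym (ℚ.*-zeroʳ q)
  Prob-const q (v ∷ vs) d = begin
    Prob ((q , v) ∷ map (q ,_) vs) d                      ≡⟨ Prob-∷ q v _ d ⟩
    q ℚ.* ι (count d (v ∷ [])) ℚ.+ Prob (map (q ,_) vs) d
      ≡⟨ cong (q ℚ.* ι (count d (v ∷ [])) ℚ.+_) (Prob-const q vs d) ⟩
    q ℚ.* ι (count d (v ∷ [])) ℚ.+ q ℚ.* ι (count d vs)   ≡⟨ ℚ.*-distribˡ-+ q _ _ ⟨
    q ℚ.* (ι (count d (v ∷ [])) ℚ.+ ι (count d vs))       ≡⟨ cong (q ℚ.*_) (ι-+ (count d (v ∷ [])) _) ⟩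
    q ℚ.* ι (count d (v ∷ []) + count d vs)               ≡⟨ cong (λ n → q ℚ.* ι n) (count-++ d (v ∷ []) vs) ⟨
    q ℚ.* ι (count d (v ∷ vs))                            ∎
    where open ≡-Reasoning

  -- Multiplied out so as to cover the empty list, for which `uniform` has no outcome.
  Prob-uniform : ∀ (vs : List (Deck N)) d → Prob (uniform vs) d ℚ.* ι (length vs) ≡ ι (count d vs)
  Prob-uniform []           d = ℚ.*-zeroˡ (ι 0)
  Prob-uniform vs@(_ ∷ vs′) d = begin
    Prob (map (1/n ,_) vs) d ℚ.* ι n ≡⟨ cong (ℚ._* ι n) (Prob-const 1/n vs d) ⟩
    1/n ℚ.* ι c ℚ.* ι n              ≡⟨ cong (ℚ._* ι n) (trans (ℚ.*-comm 1/n (ι c)) (sym (/≡ι*1/ c n))) ⟩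
    (+ c ℚ./ n) ℚ.* ι n              ≡⟨ /-*-ι c n c n refl ⟩
    ι c                              ∎
    where
    open ≡-Reasoning
    n = length vs
    c = count d vs
    1/n = + 1 ℚ./ n

  Prob->>= : ∀ {A : Set} p j (D : Dist A) (f : A → Dist (Deck N)) d →
    Prob (((p , j) ∷ D) >>= f) d ≡ p ℚ.* Prob (f j) d ℚ.+ Prob (D >>= f) d
  Prob->>= p j D f d =
    trans (Prob-++ (scale p (f j)) (D >>= f) d) (cong (ℚ._+ _) (Prob-scale p (f j) d))

-- Interleavings

interleavings-[]ʳ : ∀ {A : Set} (cs : List A) → interleavings cs [] ≡ cs ∷ []
interleavings-[]ʳ []      = refl
interleavings-[]ʳ (_ ∷ _) = refl

-- The binomial coefficient in division-free form, from which ratios of lengths are obtained by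
-- cancelling factorials. In the inductive step the two choices of first card contribute
-- (m+1)(m+n+1)! and (n+1)(m+n+1)!, with `m` and `n` the lengths of the tails.
length-interleavings-! : ∀ {A : Set} (cs ds : List A) →
  length (interleavings cs ds) * ((length cs) ! * (length ds) !) ≡ (length cs + length ds) !
length-interleavings-! []       ds       = trans (ℕ.*-identityˡ _) (ℕ.*-identityˡ _)
length-interleavings-! (c ∷ cs) []       =
  trans (ℕ.*-identityˡ _) (trans (ℕ.*-identityʳ ((suc (length cs)) !)) (cong (λ n → (suc n) !) (sym (ℕ.+-identityʳ (length cs)))))
length-interleavings-! (c ∷ cs) (d ∷ ds) = begin
  length (map (c ∷_) Lˡ ++ map (d ∷_) Lʳ) * ((suc m * m !) * (suc n * n !))
    ≡⟨ cong (ℕ._* ((suc m * m !) * (suc n * n !))) (trans (List.length-++ (map (c ∷_) Lˡ))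
         (cong₂ ℕ._+_ (List.length-map _ Lˡ) (List.length-map _ Lʳ))) ⟩
  (length Lˡ + length Lʳ) * ((suc m * m !) * (suc n * n !))
    ≡⟨ expand (length Lˡ) (length Lʳ) m n (m !) (n !) ⟩
  suc m * (length Lˡ * (m ! * (suc n) !)) + suc n * (length Lʳ * ((suc m) ! * n !))
    ≡⟨ cong₂ (λ p q → suc m * p + suc n * q)
         (length-interleavings-! cs (d ∷ ds)) (length-interleavings-! (c ∷ cs) ds) ⟩
  suc m * (m + suc n) ! + suc n * (suc m + n) !
    ≡⟨ cong (λ k → suc m * (m + suc n) ! + suc n * k !) (ℕ.+-suc m n) ⟨
  suc m * (m + suc n) ! + suc n * (m + suc n) !
    ≡⟨ ℕ.*-distribʳ-+ ((m + suc n) !) (suc m) (suc n) ⟨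
  (suc m + suc n) !  ∎
  where
  open ≡-Reasoning
  Lˡ = interleavings cs (d ∷ ds)
  Lʳ = interleavings (c ∷ cs) ds
  m = length cs
  n = length ds
  expand : ∀ p q m n f g → (p + q) * ((suc m * f) * (suc n * g)) ≡
    suc m * (p * (f * (suc n * g))) + suc n * (q * ((suc m * f) * g))
  expand = ℕ-Solver.solve-∀

-- The probability that the next card comes from a stack is the proportion of
-- the interleavings which begin with a card of that stack.
module _ {A : Set} (c d : A) (cs ds : List A) where
  private
    m = length cs
    n = length ds
    total = length (interleavings (c ∷ cs) (d ∷ ds))

  length-interleavings-consˡ :
    suc m * total ≡ length (interleavings cs (d ∷ ds)) * (suc m + suc n)
  length-interleavings-consˡ = ℕ.*-cancelʳ-≡ _ _ (m ! * (suc n) !) (begin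
    suc m * total * (m ! * (suc n) !)         ≡⟨ shuffle₁ (suc m) total (m !) ((suc n) !) ⟩
    total * ((suc m) ! * (suc n) !)           ≡⟨ length-interleavings-! (c ∷ cs) (d ∷ ds) ⟩
    (suc m + suc n) * (m + suc n) !
      ≡⟨ cong ((suc m + suc n) ℕ.*_) (length-interleavings-! cs (d ∷ ds)) ⟨
    (suc m + suc n) * (l * (m ! * (suc n) !)) ≡⟨ shuffle₂ (suc m + suc n) l (m ! * (suc n) !) ⟩
    l * (suc m + suc n) * (m ! * (suc n) !)   ∎)
    where
    open ≡-Reasoning
    instance _ = ℕ.m*n≢0 (m !) ((suc n) !) {{m ℕ.!≢0}} {{suc n ℕ.!≢0}}
    l = length (interleavings cs (d ∷ ds))
    shuffle₁ : ∀ a t f g → a * t * (f * g) ≡ t * ((a * f) * g)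
    shuffle₁ = ℕ-Solver.solve-∀
    shuffle₂ : ∀ s l f → s * (l * f) ≡ l * s * f
    shuffle₂ = ℕ-Solver.solve-∀

  length-interleavings-consʳ :
    suc n * total ≡ length (interleavings (c ∷ cs) ds) * (suc m + suc n)
  length-interleavings-consʳ = ℕ.*-cancelʳ-≡ _ _ ((suc m) ! * n !) (begin
    suc n * total * ((suc m) ! * n !)         ≡⟨ shuffle₁ (suc n) total ((suc m) !) (n !) ⟩
    total * ((suc m) ! * (suc n) !)           ≡⟨ length-interleavings-! (c ∷ cs) (d ∷ ds) ⟩
    (suc m + suc n) * (m + suc n) !           ≡⟨ cong (λ k → (suc m + suc n) * k !) (ℕ.+-suc m n) ⟩
    (suc m + suc n) * (suc m + n) !
      ≡⟨ cong ((suc m + suc n) ℕ.*_) (length-interleavings-! (c ∷ cs) ds) ⟨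
    (suc m + suc n) * (l * ((suc m) ! * n !)) ≡⟨ shuffle₂ (suc m + suc n) l ((suc m) ! * n !) ⟩
    l * (suc m + suc n) * ((suc m) ! * n !)   ∎)
    where
    open ≡-Reasoning
    instance _ = ℕ.m*n≢0 ((suc m) !) (n !) {{suc m ℕ.!≢0}} {{n ℕ.!≢0}}
    l = length (interleavings (c ∷ cs) ds)
    shuffle₁ : ∀ b t f g → b * t * (f * g) ≡ t * (f * (b * g))
    shuffle₁ = ℕ-Solver.solve-∀
    shuffle₂ : ∀ s l f → s * (l * f) ≡ l * s * f
    shuffle₂ = ℕ-Solver.solve-∀

-- Dropping cards yields every interleaving with equal probability

module _ {N : ℕ} where

  drops-[]ˡ : ∀ (ds : List (Fin N)) out → drops [] ds out ≡ return (reverseAcc out ds)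
  drops-[]ˡ []       out = refl
  drops-[]ˡ (d ∷ ds) out = drops-[]ˡ ds (d ∷ out)

  drops-[]ʳ : ∀ (cs : List (Fin N)) out → drops cs [] out ≡ return (reverseAcc out cs)
  drops-[]ʳ []       out = refl
  drops-[]ʳ (c ∷ cs) out = drops-[]ʳ cs (c ∷ out)

  Prob-return : ∀ (v d : Deck N) → Prob (return v) d ℚ.* ι 1 ≡ ι (count d (v ∷ []))
  Prob-return v d = trans (ℚ.*-identityʳ _) (trans (Prob-∷ 1ℚ v [] d)
    (trans (ℚ.+-identityʳ _) (ℚ.*-identityˡ _)))

  -- The induction needs an arbitrary pile `out` of cards already dropped: continuing in the order
  -- `l` puts these cards one by one on top of it and ends with the deck `reverseAcc out l`.
  Prob-drops : ∀ cs ds (out d : Deck N) →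
    Prob (drops cs ds out) d ℚ.* ι (length (interleavings cs ds)) ≡
    ι (count d (map (reverseAcc out) (interleavings cs ds)))
  Prob-drops []       ds       out d rewrite drops-[]ˡ ds out = Prob-return (reverseAcc out ds) d
  Prob-drops (c ∷ cs) []       out d rewrite drops-[]ʳ cs (c ∷ out) = Prob-return (reverseAcc (c ∷ out) cs) d
  Prob-drops (c ∷ cs) (d′ ∷ ds) out d = begin
    Prob (scale pˡ Dˡ ++ scale pʳ Dʳ) d ℚ.* ι l
      ≡⟨ cong (ℚ._* ι l) (trans (Prob-++ (scale pˡ Dˡ) _ d) (cong₂ ℚ._+_ (Prob-scale pˡ Dˡ d) (Prob-scale pʳ Dʳ d))) ⟩
    (pˡ ℚ.* Prob Dˡ d ℚ.+ pʳ ℚ.* Prob Dʳ d) ℚ.* ι l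
      ≡⟨ ℚ.*-distribʳ-+ (ι l) (pˡ ℚ.* Prob Dˡ d) (pʳ ℚ.* Prob Dʳ d) ⟩
    pˡ ℚ.* Prob Dˡ d ℚ.* ι l ℚ.+ pʳ ℚ.* Prob Dʳ d ℚ.* ι l
      ≡⟨ cong₂ ℚ._+_ (branch pˡ (Prob Dˡ d) (length Lˡ) (/-*-ι (suc (length cs)) l (length Lˡ) _ (length-interleavings-consˡ c d′ cs ds)))
                     (branch pʳ (Prob Dʳ d) (length Lʳ) (/-*-ι (suc (length ds)) l (length Lʳ) _ (length-interleavings-consʳ c d′ cs ds))) ⟩
    Prob Dˡ d ℚ.* ι (length Lˡ) ℚ.+ Prob Dʳ d ℚ.* ι (length Lʳ)
      ≡⟨ cong₂ ℚ._+_ (Prob-drops cs (d′ ∷ ds) (c ∷ out) d) (Prob-drops (c ∷ cs) ds (d′ ∷ out) d) ⟩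
    ι (count d (map (reverseAcc (c ∷ out)) Lˡ)) ℚ.+ ι (count d (map (reverseAcc (d′ ∷ out)) Lʳ))
      ≡⟨ ι-+ (count d (map (reverseAcc (c ∷ out)) Lˡ)) _ ⟩
    ι (count d (map (reverseAcc (c ∷ out)) Lˡ) + count d (map (reverseAcc (d′ ∷ out)) Lʳ))
      ≡⟨ cong ι (cong₂ (λ p q → count d p + count d q) (List.map-∘ Lˡ) (List.map-∘ Lʳ)) ⟩
    ι (count d (map (reverseAcc out) (map (c ∷_) Lˡ)) + count d (map (reverseAcc out) (map (d′ ∷_) Lʳ)))
      ≡⟨ cong ι (count-++ d (map (reverseAcc out) (map (c ∷_) Lˡ)) _) ⟨
    ι (count d (map (reverseAcc out) (map (c ∷_) Lˡ) ++ map (reverseAcc out) (map (d′ ∷_) Lʳ)))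
      ≡⟨ cong (λ L → ι (count d L)) (List.map-++ (reverseAcc out) (map (c ∷_) Lˡ) _) ⟨
    ι (count d (map (reverseAcc out) (map (c ∷_) Lˡ ++ map (d′ ∷_) Lʳ))) ∎
    where
    open ≡-Reasoning
    Lˡ = interleavings cs (d′ ∷ ds)
    Lʳ = interleavings (c ∷ cs) ds
    l = length (interleavings (c ∷ cs) (d′ ∷ ds))
    pˡ = + suc (length cs) ℚ./ (suc (length cs) + suc (length ds))
    pʳ = + suc (length ds) ℚ./ (suc (length cs) + suc (length ds))
    Dˡ = drops cs (d′ ∷ ds) (c ∷ out)
    Dʳ = drops (c ∷ cs) ds (d′ ∷ out)
    branch : ∀ p P l′ → p ℚ.* ι l ≡ ι l′ → p ℚ.* P ℚ.* ι l ≡ P ℚ.* ι l′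
    branch p P l′ eq = begin
      p ℚ.* P ℚ.* ι l   ≡⟨ cong (ℚ._* ι l) (ℚ.*-comm p P) ⟩
      P ℚ.* p ℚ.* ι l   ≡⟨ ℚ.*-assoc P p (ι l) ⟩
      P ℚ.* (p ℚ.* ι l) ≡⟨ cong (P ℚ.*_) eq ⟩
      P ℚ.* ι l′        ∎

∈-interleavings⁺ : ∀ {A : Set} (cs ds : List A) {l} → Interleaving cs ds l → l ∈ interleavings cs ds
∈-interleavings⁺ []       []       []         = here refl
∈-interleavings⁺ []       (d ∷ ds) (consʳ il) with here refl ← ∈-interleavings⁺ [] ds il = here refl
∈-interleavings⁺ (c ∷ cs) []       (consˡ il)
  with here refl ← subst (_ ∈_) (interleavings-[]ʳ cs) (∈-interleavings⁺ cs [] il) = here refl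
∈-interleavings⁺ (c ∷ cs) (d ∷ ds) (consˡ il) = ∈-++⁺ˡ (∈-map⁺ _ (∈-interleavings⁺ cs (d ∷ ds) il))
∈-interleavings⁺ (c ∷ cs) (d ∷ ds) (consʳ il) =
  ∈-++⁺ʳ (map (c ∷_) (interleavings cs (d ∷ ds))) (∈-map⁺ _ (∈-interleavings⁺ (c ∷ cs) ds il))

∈-interleavings⁻ : ∀ {A : Set} (cs ds : List A) {l} → l ∈ interleavings cs ds → Interleaving cs ds l
∈-interleavings⁻ []       []       (here refl) = []
∈-interleavings⁻ []       (d ∷ ds) (here refl) = consʳ (∈-interleavings⁻ [] ds (here refl))
∈-interleavings⁻ (c ∷ cs) []       (here refl) =
  consˡ (∈-interleavings⁻ cs [] (subst (cs ∈_) (sym (interleavings-[]ʳ cs)) (here refl)))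
∈-interleavings⁻ (c ∷ cs) (d ∷ ds) l∈ with ∈-++⁻ (map (c ∷_) (interleavings cs (d ∷ ds))) l∈
... | inj₁ p with _ , q , refl ← ∈-map⁻ (c ∷_) p = consˡ (∈-interleavings⁻ cs (d ∷ ds) q)
... | inj₂ p with _ , q , refl ← ∈-map⁻ (d ∷_) p = consʳ (∈-interleavings⁻ (c ∷ cs) ds q)

-- Disjointness separates the two halves of the list by their first card; with a card common to both
-- lists the same result could arise twice.
interleavings-unique : ∀ {A : Set} (cs ds : List A) → Disjoint cs ds → Unique (interleavings cs ds)
interleavings-unique []       ds       _    = [] ∷ []
interleavings-unique (c ∷ cs) []       _    = [] ∷ []
interleavings-unique (c ∷ cs) (d ∷ ds) disj = Unique.++⁺
  (Unique.map⁺ List.∷-injectiveʳ (interleavings-unique cs (d ∷ ds) λ (p , q) → disj (there p , q)))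
  (Unique.map⁺ List.∷-injectiveʳ (interleavings-unique (c ∷ cs) ds λ (p , q) → disj (p , there q)))
  heads-differ
  where
  heads-differ : Disjoint (map (c ∷_) (interleavings cs (d ∷ ds))) (map (d ∷_) (interleavings (c ∷ cs) ds))
  heads-differ (p , q) with ∈-map⁻ (c ∷_) p | ∈-map⁻ (d ∷_) q
  ... | _ , _ , refl | _ , _ , refl = disj (here refl , here refl)

module _ {N : ℕ} where
  open DecMembership (_≟ᴰ_ {N}) using (_∈?_)

  count-∉ : ∀ {d : Deck N} {L} → d ∉ L → count d L ≡ 0
  count-∉ {d} d∉L = cong length (List.filter-none (_≟ᴰ d) (All.tabulate λ { x∈L refl → d∉L x∈L }))

  count-∈ : ∀ {d : Deck N} {L} → Unique L → d ∈ L → count d L ≡ 1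
  count-∈ {d} {v ∷ L} (v∉ ∷ _) (here refl) = trans (cong length (List.filter-accept (_≟ᴰ d) refl))
    (cong suc (count-∉ (λ d∈L → All.lookup v∉ d∈L refl)))
  count-∈ {d} {v ∷ L} (v∉ ∷ u) (there d∈L) =
    trans (cong length (List.filter-reject (_≟ᴰ d) (All.lookup v∉ d∈L))) (count-∈ u d∈L)

  count-cong : ∀ {d : Deck N} {L M} → Unique L → Unique M → (d ∈ L → d ∈ M) → (d ∈ M → d ∈ L) →
    count d L ≡ count d M
  count-cong {d} {L} uL uM L⇒M M⇒L with d ∈? L
  ... | yes d∈L = trans (count-∈ uL d∈L) (sym (count-∈ uM (L⇒M d∈L)))
  ... | no  d∉L = trans (count-∉ d∉L) (sym (count-∉ (d∉L ∘ M⇒L)))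

  -- Cards are dropped from the bottom, so `drops` interleaves the reversed stacks. Reversal
  -- preserves being an interleaving, and for duplicate-free lists agreement of membership is enough
  -- for the counts.
  count-reversed : ∀ {s₁ s₂ : Deck N} d → Disjoint s₁ s₂ →
    count d (map reverse (interleavings (reverse s₁) (reverse s₂))) ≡ count d (interleavings s₁ s₂)
  count-reversed {s₁} {s₂} d disj = count-cong
    (Unique.map⁺ List.reverse-injective (interleavings-unique _ _ λ (p , q) → disj (Perm.∈-resp-↭ (Perm.↭-reverse s₁) p , Perm.∈-resp-↭ (Perm.↭-reverse s₂) q)))
    (interleavings-unique _ _ disj)
    (λ d∈ → let l , l∈ , d≡ = ∈-map⁻ reverse d∈ in
      ∈-interleavings⁺ s₁ s₂ (Interleaving.reverse⁻ (subst (Interleaving (reverse s₁) (reverse s₂))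
        (sym (trans (cong reverse d≡) (List.reverse-involutive l))) (∈-interleavings⁻ (reverse s₁) (reverse s₂) l∈))))
    (λ d∈ → subst (_∈ map reverse (interleavings (reverse s₁) (reverse s₂))) (List.reverse-involutive d)
      (∈-map⁺ reverse (∈-interleavings⁺ (reverse s₁) (reverse s₂) (Interleaving.reverse⁺ (∈-interleavings⁻ s₁ s₂ d∈)))))

  Prob-dropCards : ∀ {s₁ s₂ : Deck N} d → Disjoint s₁ s₂ →
    Prob (dropCards (s₁ , s₂)) d ℚ.* ι (length (interleavings s₁ s₂)) ≡ ι (count d (interleavings s₁ s₂))
  Prob-dropCards {s₁} {s₂} d disj = begin
    P ℚ.* ι (length (interleavings s₁ s₂))                              ≡⟨ cong (λ l → P ℚ.* ι l) lengths ⟨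
    P ℚ.* ι (length (interleavings (reverse s₁) (reverse s₂)))
      ≡⟨ Prob-drops (reverse s₁) (reverse s₂) [] d ⟩
    ι (count d (map reverse (interleavings (reverse s₁) (reverse s₂)))) ≡⟨ cong ι (count-reversed d disj) ⟩
    ι (count d (interleavings s₁ s₂))                                   ∎
    where
    open ≡-Reasoning
    P = Prob (dropCards (s₁ , s₂)) d
    lengths : length (interleavings (reverse s₁) (reverse s₂)) ≡ length (interleavings s₁ s₂)
    lengths = trans (length-interleavings (reverse s₁) (reverse s₂))
      (trans (cong₂ (λ m n → (m + n) C n) (List.length-reverse s₁) (List.length-reverse s₂))
             (sym (length-interleavings s₁ s₂)))

  interleavings-nonempty : ∀ {A : Set} (cs ds : List A) → NonZero (length (interleavings cs ds))
  interleavings-nonempty cs ds = ℕ.m*n≢0⇒m≢0 (length (interleavings cs ds))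
    {{subst NonZero (sym (length-interleavings-! cs ds)) ((length cs + length ds) ℕ.!≢0)}}

  Prob-dropCards-uniform : ∀ {s₁ s₂ : Deck N} d → Disjoint s₁ s₂ →
    Prob (dropCards (s₁ , s₂)) d ≡ Prob (interleaveUniformly (s₁ , s₂)) d
  Prob-dropCards-uniform {s₁} {s₂} d disj =
    *-ι-cancel (length (interleavings s₁ s₂)) {{interleavings-nonempty s₁ s₂}}
    (trans (Prob-dropCards d disj) (sym (Prob-uniform (interleavings s₁ s₂) d)))

-- The cut of the deck and the total weight of an outcome

take-drop-disjoint : ∀ {A : Set} k {xs : List A} → Unique xs → Disjoint (take k xs) (drop k xs)
take-drop-disjoint (suc k) {_ ∷ xs} (x∉ ∷ u) (here refl , q) =
  All.lookup x∉ (subst (_ ∈_) (List.take++drop≡id k xs) (∈-++⁺ʳ (take k xs) q)) refl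
take-drop-disjoint (suc k) (x∉ ∷ u) (there p , q)   = take-drop-disjoint k u (p , q)

2j≤N⇒j≤N∸j : ∀ {N j} → j + j ≤ N → j ≤ N ∸ j
2j≤N⇒j≤N∸j {N} {j} 2j≤N = subst (ℕ._≤ N ∸ j) (ℕ.m+n∸n≡m j j) (ℕ.∸-monoˡ-≤ j 2j≤N)

module _ {N} j (2j≤N : j + j ≤ N) (xs : Deck N) where
  private
    m = N ∸ j
    j≤m : j ≤ m
    j≤m = 2j≤N⇒j≤N∸j 2j≤N

    -- This is where 2j ≤ N enters: the top `j` cards survive the removal of the bottom `j`.
    take-take : take j (take m xs) ≡ take j xs
    take-take = trans (List.take-take j m xs) (cong (λ k → take k xs) (ℕ.m≤n⇒m⊓n≡m j≤m))

  cut-disjoint : Unique xs → Disjoint (proj₁ (cut j xs)) (proj₂ (cut j xs))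
  cut-disjoint u (p , q) with ∈-++⁻ (drop m xs) q
  ... | inj₁ q =
      take-drop-disjoint m u (subst (_ ∈_) (List.take++drop≡id j (take m xs)) (∈-++⁺ʳ (take j (take m xs)) p) , q)
  ... | inj₂ q = take-drop-disjoint j (Unique.take⁺ m u) (subst (_ ∈_) (sym take-take) q , p)

  cut-↭ : proj₁ (cut j xs) ++ proj₂ (cut j xs) ↭ xs
  cut-↭ = begin
    s₁ ++ (drop m xs ++ take j xs)          ↭⟨ Perm.++⁺ˡ s₁ (Perm.++-comm (drop m xs) (take j xs)) ⟩
    s₁ ++ (take j xs ++ drop m xs)          ≡⟨ List.++-assoc s₁ (take j xs) (drop m xs) ⟨
    (s₁ ++ take j xs) ++ drop m xs          ↭⟨ Perm.++⁺ʳ (drop m xs) (Perm.++-comm s₁ (take j xs)) ⟩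
    (take j xs ++ s₁) ++ drop m xs          ≡⟨ cong (λ t → (t ++ s₁) ++ drop m xs) take-take ⟨
    (take j (take m xs) ++ s₁) ++ drop m xs ≡⟨ cong (_++ drop m xs) (List.take++drop≡id j (take m xs)) ⟩
    take m xs ++ drop m xs                  ≡⟨ List.take++drop≡id m xs ⟩
    xs                                      ∎
    where
    open PermutationReasoning
    s₁ = drop j (take m xs)

  length-interleavings-cut : length xs ≡ N →
    length (interleavings (proj₁ (cut j xs)) (proj₂ (cut j xs))) ≡ N C (2 * j)
  length-interleavings-cut |xs| = trans (length-interleavings s₁ s₂) (cong₂ _C_ total pile)
    where
    s₁ = proj₁ (cut j xs)
    s₂ = proj₂ (cut j xs)
    total : length s₁ + length s₂ ≡ N
    total = trans (sym (List.length-++ s₁)) (trans (Perm.↭-length cut-↭) |xs|)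
    j≤N : j ≤ N
    j≤N = ℕ.≤-trans j≤m (ℕ.m∸n≤m N j)
    pile : length s₂ ≡ 2 * j
    pile = trans (List.length-++ (drop m xs)) (cong₂ ℕ._+_
      (trans (List.length-drop m xs) (trans (cong (_∸ m) |xs|) (ℕ.m∸[m∸n]≡n j≤N)))
      (trans (List.length-take j xs) (trans (cong (j ℕ.⊓_) |xs|) (trans (ℕ.m≤n⇒m⊓n≡m j≤N) (sym (ℕ.+-identityʳ j))))))

j≤N/2⇒2j≤N : ∀ {N j} → j ≤ ⌊ N /2⌋ → j + j ≤ N
j≤N/2⇒2j≤N {N} j≤ =
  ℕ.≤-trans (ℕ.+-mono-≤ j≤ (ℕ.≤-trans j≤ (ℕ.⌊n/2⌋≤⌈n/2⌉ N))) (ℕ.≤-reflexive (ℕ.⌊n/2⌋+⌈n/2⌉≡n N))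

riffles : ∀ {N} → ℕ → List (Deck N)
riffles j = interleavings (proj₁ (cut j (allFin _))) (proj₂ (cut j (allFin _)))

module _ N (d : Deck N) where
  private
    instance _ = ℕ.m^n≢0 2 (N ∸ 1)
    D = 2 ^ (N ∸ 1)
    f : ℕ → Dist (Deck N)
    f j = dropCards (cut j (allFin N))

  Prob-cut : ∀ j → j + j ≤ N →
    (+ (N C (2 * j)) ℚ./ D) ℚ.* Prob (f j) d ≡ ι (count d (riffles j)) ℚ.* (+ 1 ℚ./ D)
  Prob-cut j 2j≤N = begin
    (+ c ℚ./ D) ℚ.* P                                ≡⟨ cong (ℚ._* P) (/≡ι*1/ c D) ⟩
    ι c ℚ.* (+ 1 ℚ./ D) ℚ.* P                        ≡⟨ ℚ.*-comm (ι c ℚ.* (+ 1 ℚ./ D)) P ⟩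
    P ℚ.* (ι c ℚ.* (+ 1 ℚ./ D))                      ≡⟨ ℚ.*-assoc P (ι c) (+ 1 ℚ./ D) ⟨
    P ℚ.* ι c ℚ.* (+ 1 ℚ./ D)
      ≡⟨ cong (λ n → P ℚ.* ι n ℚ.* (+ 1 ℚ./ D)) (length-interleavings-cut j 2j≤N (allFin N) (List.length-tabulate id)) ⟨
    P ℚ.* ι (length (riffles {N} j)) ℚ.* (+ 1 ℚ./ D)
      ≡⟨ cong (ℚ._* (+ 1 ℚ./ D)) (Prob-dropCards d (cut-disjoint j 2j≤N (allFin N) (Unique.allFin⁺ N))) ⟩
    ι (count d (riffles j)) ℚ.* (+ 1 ℚ./ D)          ∎
    where
    open ≡-Reasoning
    c = N C (2 * j)
    P = Prob (f j) d

  private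
    weigh : ℕ → ℚ × ℕ
    weigh j = (+ (N C (2 * j)) ℚ./ D) , j

  Prob-cuts : ∀ js → All (λ j → j + j ≤ N) js →
    Prob (map weigh js >>= f) d ≡ ι (sum (map (λ j → count d (riffles j)) js)) ℚ.* (+ 1 ℚ./ D)
  Prob-cuts []       []       = sym (ℚ.*-zeroˡ (+ 1 ℚ./ D))
  Prob-cuts (j ∷ js) (p ∷ ps) = begin
    Prob (weigh j ∷ map weigh js >>= f) d
      ≡⟨ Prob->>= (+ (N C (2 * j)) ℚ./ D) j (map weigh js) f d ⟩
    (+ (N C (2 * j)) ℚ./ D) ℚ.* Prob (f j) d ℚ.+ Prob (map weigh js >>= f) d
      ≡⟨ cong₂ ℚ._+_ (Prob-cut j p) (Prob-cuts js ps) ⟩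
    ι (count d (riffles j)) ℚ.* (+ 1 ℚ./ D) ℚ.+ ι rest ℚ.* (+ 1 ℚ./ D)
      ≡⟨ ℚ.*-distribʳ-+ (+ 1 ℚ./ D) (ι (count d (riffles j))) (ι rest) ⟨
    (ι (count d (riffles j)) ℚ.+ ι rest) ℚ.* (+ 1 ℚ./ D)
      ≡⟨ cong (ℚ._* (+ 1 ℚ./ D)) (ι-+ (count d (riffles j)) rest) ⟩
    ι (count d (riffles j) + rest) ℚ.* (+ 1 ℚ./ D) ∎
    where
    open ≡-Reasoning
    rest = sum (map (λ j → count d (riffles j)) js)

  Prob-shuffle : Prob (shuffle N) d ≡
    (+ sum (map (λ j → count d (riffles j)) (upTo (suc ⌊ N /2⌋)))) ℚ./ D
  Prob-shuffle = trans
    (Prob-cuts (upTo (suc ⌊ N /2⌋)) (All.tabulate (j≤N/2⇒2j≤N ∘ ℕ.s≤s⁻¹ ∘ ∈-upTo⁻)))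
    (sym (/≡ι*1/ (sum (map (λ j → count d (riffles j)) (upTo (suc ⌊ N /2⌋)))) D))

-- Cyclic descents

lookup-ext : ∀ {A : Set} {n} {u v : Vec A n} → (∀ i → lookup u i ≡ lookup v i) → u ≡ v
lookup-ext {u = u} {v} u≗v =
  trans (sym (Vec.tabulate∘lookup u)) (trans (Vec.tabulate-cong u≗v) (Vec.tabulate∘lookup v))

module _ {n} {P : Fin n → Set} (P? : Decidable P) where

  ∈-tabulate⁺ : ∀ {i} → P i → i ∈ₛ Vec.tabulate (does ∘ P?)
  ∈-tabulate⁺ {i} p = Vec.lookup⇒[]= i _ (trans (Vec.lookup∘tabulate (does ∘ P?) i) (dec-true (P? i) p))

  ∈-tabulate⁻ : ∀ {i} → i ∈ₛ Vec.tabulate (does ∘ P?) → P i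
  ∈-tabulate⁻ {i} i∈ with P? i in eq
  ... | yes p = p
  ... | no _  =
      contradiction (trans (sym (trans (Vec.lookup∘tabulate (does ∘ P?) i) (cong does eq))) (Vec.[]=⇒lookup i∈)) λ ()

lookup-e-≡ : ∀ {N} (i : Fin N) → lookup (e i) i ≡ 1ℤ
lookup-e-≡ {N} i = Vec.lookup∘update i (Vec.replicate N 0ℤ) 1ℤ

lookup-e-≢ : ∀ {N} {i j : Fin N} → j ≢ i → lookup (e i) j ≡ 0ℤ
lookup-e-≢ {N} {j = j} j≢i = trans (Vec.lookup∘update′ j≢i (Vec.replicate N 0ℤ) 1ℤ) (Vec.lookup-replicate j 0ℤ)

lookup-e-bounds : ∀ {N} (i j : Fin N) → 0ℤ ℤ.≤ lookup (e i) j × lookup (e i) j ℤ.≤ 1ℤ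
lookup-e-bounds i j with j Fin.≟ i
... | yes refl rewrite lookup-e-≡ i   = ℤ.+≤+ z≤n , ℤ.≤-refl
... | no  j≢i  rewrite lookup-e-≢ j≢i = ℤ.≤-refl , ℤ.+≤+ z≤n

lookup-e-e : ∀ {N} (a b p : Fin N) → lookup (e a -ᵛ e b) p ≡ lookup (e a) p ℤ.- lookup (e b) p
lookup-e-e a b p = Vec.lookup-zipWith ℤ._-_ p (e a) (e b)

-- Two coordinates suffice: the entry 1 at `i` can only come from `e a`, and the entry -1 at `j`
-- only from `e b`.
Negative-e-e⁻ : ∀ {N} {a b : Fin N} → Negative (e a -ᵛ e b) → b Fin.< a
Negative-e-e⁻ {a = a} {b} (i , j , j<i , eq) = subst₂ Fin._<_ (sym b≡j) (sym a≡i) j<i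
  where
  i≢j : i ≢ j
  i≢j = Fin.<⇒≢ j<i ∘ sym
  at : ∀ p → lookup (e a) p ℤ.- lookup (e b) p ≡ lookup (e i) p ℤ.- lookup (e j) p
  at p = trans (sym (lookup-e-e a b p)) (trans (cong (λ v → lookup v p) eq) (lookup-e-e i j p))
  a≡i : a ≡ i
  a≡i with i Fin.≟ a
  ... | yes i≡a = sym i≡a
  ... | no  i≢a = contradiction ≤0 λ { (ℤ.+≤+ ()) }
    where
    open ℤ.≤-Reasoning
    ≤0 : 1ℤ ℤ.≤ 0ℤ
    ≤0 = begin
      1ℤ ℤ.- 0ℤ                         ≡⟨ cong₂ ℤ._-_ (lookup-e-≡ i) (lookup-e-≢ i≢j) ⟨
      lookup (e i) i ℤ.- lookup (e j) i ≡⟨ at i ⟨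
      lookup (e a) i ℤ.- lookup (e b) i ≡⟨ cong (ℤ._- lookup (e b) i) (lookup-e-≢ i≢a) ⟩
      0ℤ ℤ.- lookup (e b) i             ≤⟨ ℤ.+-monoʳ-≤ 0ℤ (ℤ.neg-mono-≤ (proj₁ (lookup-e-bounds b i))) ⟩
      0ℤ                                ∎
  b≡j : b ≡ j
  b≡j with j Fin.≟ b
  ... | yes j≡b = sym j≡b
  ... | no  j≢b = contradiction ≥0 λ ()
    where
    open ℤ.≤-Reasoning
    ≥0 : 0ℤ ℤ.≤ ℤ.- 1ℤ
    ≥0 = begin
      0ℤ                                ≤⟨ proj₁ (lookup-e-bounds a j) ⟩
      lookup (e a) j                    ≡⟨ ℤ.+-identityʳ _ ⟨
      lookup (e a) j ℤ.- 0ℤ             ≡⟨ cong (λ z → lookup (e a) j ℤ.- z) (lookup-e-≢ j≢b) ⟨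
      lookup (e a) j ℤ.- lookup (e b) j ≡⟨ at j ⟩
      lookup (e i) j ℤ.- lookup (e j) j ≡⟨ cong₂ ℤ._-_ (lookup-e-≢ (i≢j ∘ sym)) (lookup-e-≡ j) ⟩
      ℤ.- 1ℤ                            ∎

·-e-e : ∀ {N} (w : Permutation′ N) a b → w · (e a -ᵛ e b) ≡ e (w ⟨$⟩ʳ a) -ᵛ e (w ⟨$⟩ʳ b)
·-e-e w a b = lookup-ext λ p → begin
  lookup (w · (e a -ᵛ e b)) p                         ≡⟨ Vec.lookup∘tabulate _ p ⟩
  lookup (e a -ᵛ e b) (w ⟨$⟩ˡ p)                      ≡⟨ lookup-e-e a b (w ⟨$⟩ˡ p) ⟩
  lookup (e a) (w ⟨$⟩ˡ p) ℤ.- lookup (e b) (w ⟨$⟩ˡ p) ≡⟨ cong₂ ℤ._-_ (permute a p) (permute b p) ⟩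
  lookup (e (w ⟨$⟩ʳ a)) p ℤ.- lookup (e (w ⟨$⟩ʳ b)) p ≡⟨ lookup-e-e (w ⟨$⟩ʳ a) (w ⟨$⟩ʳ b) p ⟨
  lookup (e (w ⟨$⟩ʳ a) -ᵛ e (w ⟨$⟩ʳ b)) p             ∎
  where
  open ≡-Reasoning
  permute : ∀ a p → lookup (e a) (w ⟨$⟩ˡ p) ≡ lookup (e (w ⟨$⟩ʳ a)) p
  permute a p with p Fin.≟ w ⟨$⟩ʳ a
  ... | yes refl = trans (cong (lookup (e a)) (inverseˡ w)) (trans (lookup-e-≡ a) (sym (lookup-e-≡ (w ⟨$⟩ʳ a))))
  ... | no  p≢wa =
      trans (lookup-e-≢ λ eq → p≢wa (trans (sym (inverseʳ w)) (cong (w ⟨$⟩ʳ_) eq))) (sym (lookup-e-≢ p≢wa))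

-- With this form the affine root, like the simple ones, is a difference of two basis vectors, and
-- membership in `Cdes` becomes a comparison of two values of `w`.
α-zero : ∀ {r} → α {suc r} zero ≡ e (fromℕ r) -ᵛ e zero
α-zero {r} = lookup-ext λ p → begin
  lookup (Vec.map ℤ.-_ θ) p                                  ≡⟨ Vec.lookup-map p ℤ.-_ θ ⟩
  ℤ.- lookup (θ {r}) p                                       ≡⟨ cong ℤ.-_ (lookup-e-e zero (fromℕ r) p) ⟩
  ℤ.- (lookup (e {suc r} zero) p ℤ.- lookup (e (fromℕ r)) p) ≡⟨ swap (lookup (e {suc r} zero) p) _ ⟩
  lookup (e (fromℕ r)) p ℤ.- lookup (e {suc r} zero) p       ≡⟨ lookup-e-e (fromℕ r) zero p ⟨
  lookup (e (fromℕ r) -ᵛ e zero) p                           ∎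
  where
  open ≡-Reasoning
  swap : ∀ u v → ℤ.- (u ℤ.- v) ≡ v ℤ.- u
  swap = ℤ-Solver.solve-∀

module _ {r} (w : Permutation′ (suc r)) where
  private
    negative-e-e : ∀ {i} {a b : Fin (suc r)} → α i ≡ e a -ᵛ e b → w · α i ≡ e (w ⟨$⟩ʳ a) -ᵛ e (w ⟨$⟩ʳ b)
    negative-e-e {a = a} {b} eq = trans (cong (w ·_) eq) (·-e-e w a b)

    Cdes⁺ : ∀ {i} {a b : Fin (suc r)} → α i ≡ e a -ᵛ e b → w ⟨$⟩ʳ b Fin.< w ⟨$⟩ʳ a → i ∈ₛ Cdes w
    Cdes⁺ {i} eq wb<wa = ∈-tabulate⁺ (λ i → negative? (w · α i)) (_ , _ , wb<wa , negative-e-e {i} eq)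

    Cdes⁻ : ∀ {i} {a b : Fin (suc r)} → α i ≡ e a -ᵛ e b → i ∈ₛ Cdes w → w ⟨$⟩ʳ b Fin.< w ⟨$⟩ʳ a
    Cdes⁻ {i} eq i∈ =
      Negative-e-e⁻ (subst Negative (negative-e-e {i} eq) (∈-tabulate⁻ (λ i → negative? (w · α i)) i∈))

  zero∈Cdes⁺ : w ⟨$⟩ʳ zero Fin.< w ⟨$⟩ʳ fromℕ r → zero ∈ₛ Cdes w
  zero∈Cdes⁺ = Cdes⁺ α-zero

  zero∈Cdes⁻ : zero ∈ₛ Cdes w → w ⟨$⟩ʳ zero Fin.< w ⟨$⟩ʳ fromℕ r
  zero∈Cdes⁻ = Cdes⁻ α-zero

  suc∈Cdes⁺ : ∀ {i} → w ⟨$⟩ʳ suc i Fin.< w ⟨$⟩ʳ inject₁ i → suc i ∈ₛ Cdes w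
  suc∈Cdes⁺ = Cdes⁺ refl

  suc∈Cdes⁻ : ∀ {i} → suc i ∈ₛ Cdes w → w ⟨$⟩ʳ suc i Fin.< w ⟨$⟩ʳ inject₁ i
  suc∈Cdes⁻ = Cdes⁻ refl

-- Lattice points of the dilated alcove

𝟙[_<_] : ℕ → ℕ → ℤ
𝟙[ i < j ] = if i ℕ.<ᵇ j then 1ℤ else 0ℤ

𝟙-< : ∀ {i j} → i ℕ.< j → 𝟙[ i < j ] ≡ 1ℤ
𝟙-< {zero}  {suc j} _         = refl
𝟙-< {suc i} {suc j} (s≤s i<j) = 𝟙-< i<j

𝟙-≥ : ∀ {i j} → j ≤ i → 𝟙[ i < j ] ≡ 0ℤ
𝟙-≥ {i}     {zero}  _         = refl
𝟙-≥ {suc i} {suc j} (s≤s j≤i) = 𝟙-≥ j≤i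

𝟙-bounds : ∀ i j → 0ℤ ℤ.≤ 𝟙[ i < j ] × 𝟙[ i < j ] ℤ.≤ 1ℤ
𝟙-bounds i j with i ℕ.<? j
... | yes i<j rewrite 𝟙-< i<j           = ℤ.+≤+ z≤n , ℤ.≤-refl
... | no  i≮j rewrite 𝟙-≥ (ℕ.≮⇒≥ i≮j) = ℤ.≤-refl , ℤ.+≤+ z≤n

𝟙-antitone : ∀ i j → 𝟙[ suc i < j ] ℤ.≤ 𝟙[ i < j ]
𝟙-antitone i j with suc i ℕ.<? j
... | yes si<j rewrite 𝟙-< si<j | 𝟙-< (ℕ.<-trans (ℕ.n<1+n i) si<j) = ℤ.≤-refl
... | no  si≮j rewrite 𝟙-≥ (ℕ.≮⇒≥ si≮j) = proj₁ (𝟙-bounds i j)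

𝟙-const : ∀ i j → suc i ≢ j → 𝟙[ suc i < j ] ≡ 𝟙[ i < j ]
𝟙-const i       zero                _   = refl
𝟙-const zero    (suc zero)          1≢1 = contradiction refl 1≢1
𝟙-const zero    (suc (suc j))       _   = refl
𝟙-const (suc i) (suc j)             neq = 𝟙-const i j (neq ∘ cong suc)

-- Writing decreasing vectors with entries in {-1, 0, 1} as sums of indicator
-- functions makes sums and differences of their entries linear.
step : ∀ N → ℕ → ℕ → Vec ℤ N
step N p q = Vec.tabulate λ i → 𝟙[ toℕ i < p ] ℤ.+ 𝟙[ toℕ i < q ] ℤ.- 1ℤ

lookup-step : ∀ {N} p q (i : Fin N) → lookup (step N p q) i ≡ 𝟙[ toℕ i < p ] ℤ.+ 𝟙[ toℕ i < q ] ℤ.- 1ℤ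
lookup-step p q = Vec.lookup∘tabulate _

sum-step : ∀ N {p q} → p ≤ N → q ≤ N → sumᵛ (step N p q) ≡ (+ p ℤ.+ + q) ℤ.- + N
sum-step zero                      z≤n       z≤n       = refl
sum-step (suc N) {zero}  {zero}  p≤N       q≤N       =
  trans (cong (λ z → -[1+ 0 ] ℤ.+ z) (sum-step N {0} {0} z≤n z≤n)) (shift (+ N))
  where
  shift : ∀ n → -[1+ 0 ] ℤ.+ (0ℤ ℤ.+ 0ℤ ℤ.- n) ≡ 0ℤ ℤ.+ 0ℤ ℤ.- (1ℤ ℤ.+ n)
  shift = ℤ-Solver.solve-∀
sum-step (suc N) {zero}  {suc q} p≤N       (s≤s q≤N) =
  trans (cong (λ z → 0ℤ ℤ.+ z) (sum-step N {0} {q} z≤n q≤N)) (shift (+ q) (+ N))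
  where
  shift : ∀ q n → 0ℤ ℤ.+ (0ℤ ℤ.+ q ℤ.- n) ≡ 0ℤ ℤ.+ (1ℤ ℤ.+ q) ℤ.- (1ℤ ℤ.+ n)
  shift = ℤ-Solver.solve-∀
sum-step (suc N) {suc p} {zero}  (s≤s p≤N) q≤N       =
  trans (cong (λ z → 0ℤ ℤ.+ z) (sum-step N {p} {0} p≤N z≤n)) (shift (+ p) (+ N))
  where
  shift : ∀ p n → 0ℤ ℤ.+ (p ℤ.+ 0ℤ ℤ.- n) ≡ (1ℤ ℤ.+ p) ℤ.+ 0ℤ ℤ.- (1ℤ ℤ.+ n)
  shift = ℤ-Solver.solve-∀
sum-step (suc N) {suc p} {suc q} (s≤s p≤N) (s≤s q≤N) =
  trans (cong (λ z → 1ℤ ℤ.+ z) (sum-step N {p} {q} p≤N q≤N)) (shift (+ p) (+ q) (+ N))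
  where
  shift : ∀ p q n → 1ℤ ℤ.+ (p ℤ.+ q ℤ.- n) ≡ (1ℤ ℤ.+ p) ℤ.+ (1ℤ ℤ.+ q) ℤ.- (1ℤ ℤ.+ n)
  shift = ℤ-Solver.solve-∀

sum-≤-entry : ∀ {N} (t : Vec ℤ N) → (∀ i → lookup t i ℤ.≤ 0ℤ) → ∀ i → sumᵛ t ℤ.≤ lookup t i
sum-≤-entry (z ∷ t) ≤0 zero    =
  subst (z ℤ.+ sumᵛ t ℤ.≤_) (ℤ.+-identityʳ z) (ℤ.+-monoʳ-≤ z (sum-nonpos t (≤0 ∘ suc)))
sum-≤-entry (z ∷ t) ≤0 (suc i) =
  subst (z ℤ.+ sumᵛ t ℤ.≤_) (ℤ.+-identityˡ _) (ℤ.+-mono-≤ (≤0 zero) (sum-≤-entry t (≤0 ∘ suc) i))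

entry-≤-sum : ∀ {N} (t : Vec ℤ N) → (∀ i → 0ℤ ℤ.≤ lookup t i) → ∀ i → lookup t i ℤ.≤ sumᵛ t
entry-≤-sum (z ∷ t) 0≤ zero    =
  subst (ℤ._≤ z ℤ.+ sumᵛ t) (ℤ.+-identityʳ z) (ℤ.+-monoʳ-≤ z (sum-nonneg t (0≤ ∘ suc)))
entry-≤-sum (z ∷ t) 0≤ (suc i) =
  subst (ℤ._≤ z ℤ.+ sumᵛ t) (ℤ.+-identityˡ _) (ℤ.+-mono-≤ (0≤ zero) (entry-≤-sum t (0≤ ∘ suc) i))

Decreasing : ∀ {r} → Vec ℤ (suc r) → Set
Decreasing t = ∀ i → lookup t (suc i) ℤ.≤ lookup t (inject₁ i)

decreasing-antitone : ∀ {r} (t : Vec ℤ (suc r)) → Decreasing t →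
  ∀ {i j} → i Fin.≤ j → lookup t j ℤ.≤ lookup t i
decreasing-antitone t             dec {zero}  {j}     _         = first-max t dec j
decreasing-antitone t@(_ ∷ _ ∷ _) dec {suc i} {suc j} (s≤s i≤j) =
  decreasing-antitone (Vec.tail t) (dec ∘ suc) i≤j

threshold : ∀ {N} {P : Fin N → Set} → Decidable P → (∀ {i j} → i Fin.≤ j → P j → P i) →
  ∃ λ p → p ≤ N × (∀ i → P i → toℕ i ℕ.< p) × (∀ i → toℕ i ℕ.< p → P i)
threshold {zero}      P? down = 0 , z≤n , (λ ()) , λ ()
threshold {suc N} {P} P? down with P? zero
... | no ¬p = 0 , z≤n , (λ i pi → contradiction (down z≤n pi) ¬p) , λ _ ()
... | yes p with threshold (P? ∘ suc) (down ∘ s≤s)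
...   | m , m≤N , P⇒< , <⇒P = suc m , s≤s m≤N
        , (λ { zero _ → s≤s z≤n ; (suc i) pi → s≤s (P⇒< i pi) })
        , (λ { zero _ → p ; (suc i) (s≤s i<m) → <⇒P i i<m })

2j≤N⇒j≤N/2 : ∀ {N j} → j + j ≤ N → j ≤ ⌊ N /2⌋
2j≤N⇒j≤N/2 {N} {j} 2j≤N = subst (ℕ._≤ ⌊ N /2⌋) (sym (ℕ.n≡⌊n+n/2⌋ j)) (ℕ.⌊n/2⌋-mono 2j≤N)

module _ {r} (t : Vec ℤ (suc r)) (dec : Decreasing t) where
  private N = suc r

  -- Monotonicity makes the positions with entry at least 1, and those with entry at least 0,
  -- initial segments; `p` and `q` are their lengths.
  bounded-decreasing : (∀ i → ℤ.- 1ℤ ℤ.≤ lookup t i) → (∀ i → lookup t i ℤ.≤ 1ℤ) →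
    ∃ λ p → ∃ λ q → p ≤ q × q ≤ N × t ≡ step N p q
  bounded-decreasing -1≤ ≤1
    with threshold (λ i → 1ℤ ℤ.≤? lookup t i) (λ i≤j 1≤ → ℤ.≤-trans 1≤ (decreasing-antitone t dec i≤j))
       | threshold (λ i → 0ℤ ℤ.≤? lookup t i) (λ i≤j 0≤ → ℤ.≤-trans 0≤ (decreasing-antitone t dec i≤j))
  ... | p , p≤N , P⇒< , <⇒P | q , q≤N , Q⇒< , <⇒Q =
    p , q , p≤q , q≤N , lookup-ext λ i → trans (entry i) (sym (lookup-step p q i))
    where
    p≤q : p ≤ q
    p≤q with p ℕ.≤? q
    ... | yes p≤q = p≤q
    -- Position `q` would have an entry at least 1, hence at least 0, and would therefore lie below
    -- `q`.
    ... | no  p≰q =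
        contradiction (Q⇒< i (ℤ.≤-trans (ℤ.+≤+ z≤n) (<⇒P i (subst (ℕ._< p) (sym i≡q) q<p)))) (subst (λ k → ¬ k ℕ.< q) (sym i≡q) (ℕ.<-irrefl refl))
      where
      q<p = ℕ.≰⇒> p≰q
      i = fromℕ< (ℕ.<-≤-trans q<p p≤N)
      i≡q : toℕ i ≡ q
      i≡q = Fin.toℕ-fromℕ< _
    entry : ∀ i → lookup t i ≡ 𝟙[ toℕ i < p ] ℤ.+ 𝟙[ toℕ i < q ] ℤ.- 1ℤ
    entry i with lookup t i | -1≤ i | ≤1 i | P⇒< i | <⇒P i | Q⇒< i | <⇒Q i
    ... | + 0           | _ | _ | _   | <⇒1 | 0⇒< | _
        rewrite 𝟙-≥ {toℕ i} {p} (ℕ.≮⇒≥ λ i<p → contradiction (<⇒1 i<p) λ { (ℤ.+≤+ ()) }) | 𝟙-< (0⇒< ℤ.≤-refl) = refl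
    ... | + 1           | _ | _ | 1⇒< | _   | 0⇒< | _
        rewrite 𝟙-< (1⇒< ℤ.≤-refl) | 𝟙-< (0⇒< (ℤ.+≤+ z≤n)) = refl
    ... | + suc (suc _) | _ | ℤ.+≤+ (s≤s ()) | _ | _ | _ | _
    ... | -[1+ 0 ]      | _ | _ | _   | <⇒1 | _   | <⇒0
        rewrite 𝟙-≥ {toℕ i} {p} (ℕ.≮⇒≥ λ i<p → contradiction (<⇒1 i<p) λ ()) | 𝟙-≥ {toℕ i} {q} (ℕ.≮⇒≥ λ i<q → contradiction (<⇒0 i<q) λ ()) = refl
    ... | -[1+ suc _ ]  | ℤ.-≤- () | _ | _ | _ | _ | _

  -- A spread of 2 alone would allow entries from 0 to 2. But if the last entry is nonnegative, no
  -- entry exceeds the sum 0; otherwise the last entry is at most -1 and the first at most 1. The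
  -- bound from below is symmetric.
  classification : sumᵛ t ≡ 0ℤ → lookup t zero ℤ.- lookup t (fromℕ r) ℤ.≤ + 2 →
    ∃ λ j → j + j ≤ N × t ≡ step N j (N ∸ j)
  classification sum≡0 spread = let p , q , p≤q , q≤N , t≡ = bounded-decreasing -1≤ ≤1 in
    p , 2p≤N p q p≤q q≤N t≡ , trans t≡ (cong (step N p) (q≡ p q p≤q q≤N t≡))
    where
    bottom = lookup t (fromℕ r)
    top = lookup t zero
    top≤2+bottom : top ℤ.≤ + 2 ℤ.+ bottom
    top≤2+bottom = begin
      top                       ≡⟨ expand top bottom ⟩
      top ℤ.- bottom ℤ.+ bottom ≤⟨ ℤ.+-monoˡ-≤ bottom spread ⟩
      + 2 ℤ.+ bottom            ∎
      where
      open ℤ.≤-Reasoning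
      expand : ∀ a b → a ≡ a ℤ.- b ℤ.+ b
      expand = ℤ-Solver.solve-∀
    top≤1 : top ℤ.≤ 1ℤ
    top≤1 with 0ℤ ℤ.≤? bottom
    ... | yes 0≤bottom =
        ℤ.≤-trans (subst (top ℤ.≤_) sum≡0 (entry-≤-sum t (λ i → ℤ.≤-trans 0≤bottom (last-min t dec i)) zero)) (ℤ.+≤+ z≤n)
    ... | no  0≰bottom = ℤ.≤-trans top≤2+bottom (ℤ.+-monoʳ-≤ (+ 2) (ℤ.i<j⇒i≤pred[j] (ℤ.≰⇒> 0≰bottom)))
    -1≤bottom : ℤ.- 1ℤ ℤ.≤ bottom
    -1≤bottom with top ℤ.≤? 0ℤ
    ... | yes top≤0 =
        ℤ.≤-trans ℤ.-≤+ (subst (ℤ._≤ bottom) sum≡0 (sum-≤-entry t (λ i → ℤ.≤-trans (first-max t dec i) top≤0) (fromℕ r)))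
    ... | no  top≰0 =
        subst (ℤ.- 1ℤ ℤ.≤_) (cancel bottom) (ℤ.+-monoʳ-≤ (ℤ.- (+ 2)) (ℤ.≤-trans (ℤ.i<j⇒suc[i]≤j (ℤ.≰⇒> top≰0)) top≤2+bottom))
      where
      cancel : ∀ z → ℤ.- (+ 2) ℤ.+ (+ 2 ℤ.+ z) ≡ z
      cancel = ℤ-Solver.solve-∀
    -1≤ : ∀ i → ℤ.- 1ℤ ℤ.≤ lookup t i
    -1≤ i = ℤ.≤-trans -1≤bottom (last-min t dec i)
    ≤1 : ∀ i → lookup t i ℤ.≤ 1ℤ
    ≤1 i = ℤ.≤-trans (first-max t dec i) top≤1
    module _ p q (p≤q : p ≤ q) (q≤N : q ≤ N) (t≡ : t ≡ step N p q) where
      -- A step vector sums to p + q - N, so the sum 0 ties the second threshold to the first, and p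
      -- ≤ q becomes 2p ≤ N.
      p+q≡N : p + q ≡ N
      p+q≡N = ℤ.+-injective (ℤ.i-j≡0⇒i≡j _ _ (trans (sym (sum-step N (ℕ.≤-trans p≤q q≤N) q≤N)) (trans (cong sumᵛ (sym t≡)) sum≡0)))
      q≡ : q ≡ N ∸ p
      q≡ = trans (sym (ℕ.m+n∸m≡n p q)) (cong (_∸ p) p+q≡N)
      2p≤N : p + p ≤ N
      2p≤N = subst (p + p ℕ.≤_) p+q≡N (ℕ.+-monoʳ-≤ p p≤q)

-- Decks and cyclic descents

module _ {A : Set} {R : A → A → Set} where

  Linked-++⁻ : ∀ xs {ys} → Linked R (xs ++ ys) → Linked R xs × Connected R (last xs) (head ys) × Linked R ys
  Linked-++⁻ []           {[]}    l        = [] , nothing , l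
  Linked-++⁻ []           {_ ∷ _} l        = [] , nothing-just , l
  Linked-++⁻ (x ∷ [])     {[]}    l        = [-] , just-nothing , []
  Linked-++⁻ (x ∷ [])     {_ ∷ _} (r ∷ l)  = [-] , just r , l
  Linked-++⁻ (x ∷ y ∷ xs)         (r ∷ l)  = let p , q , s = Linked-++⁻ (y ∷ xs) l in r ∷ p , q , s

  -- Both stacks are made of windows of this form: from `j` to N - j for the first, from N - j to N
  -- and from 0 to `j` for the second. The bounds on `i` say that `i` and its successor both lie in
  -- the window.
  window⁺ : ∀ {r} (f : Fin (suc r) → A) j m →
    (∀ i → j ≤ toℕ i → suc (toℕ i) ℕ.< m → R (f (inject₁ i)) (f (suc i))) →
    Linked R (drop j (take m (List.tabulate f)))
  window⁺ f zero    zero    _           = []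
  window⁺ f (suc j) zero    _           = []
  window⁺ f zero    (suc zero) _        = [-]
  window⁺ {zero}  f zero    (suc (suc m)) _ = [-]
  window⁺ {suc r} f zero    (suc (suc m)) h =
    h zero z≤n (s≤s (s≤s z≤n)) ∷ window⁺ (f ∘ suc) zero (suc m) (λ i _ i<m → h (suc i) z≤n (s≤s i<m))
  window⁺ {zero}  f (suc zero) (suc zero) _    = []
  window⁺ {zero}  f (suc zero) (suc (suc m)) _ = []
  window⁺ {zero}  f (suc (suc j)) (suc zero) _    = []
  window⁺ {zero}  f (suc (suc j)) (suc (suc m)) _ = []
  window⁺ {suc r} f (suc j) (suc m) h = window⁺ (f ∘ suc) j m (λ i j≤i i<m → h (suc i) (s≤s j≤i) (s≤s i<m))

  window⁻ : ∀ {r} (f : Fin (suc r) → A) j m → Linked R (drop j (take m (List.tabulate f))) →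
    ∀ i → j ≤ toℕ i → suc (toℕ i) ℕ.< m → R (f (inject₁ i)) (f (suc i))
  window⁻ {suc r} f zero    (suc (suc m)) (p ∷ l) zero    _         _         = p
  window⁻ {suc r} f zero    (suc (suc m)) (p ∷ l) (suc i) _         (s≤s i<m) =
    window⁻ (f ∘ suc) zero (suc m) l i z≤n i<m
  window⁻ {suc r} f (suc j) (suc m)       l       (suc i) (s≤s j≤i) (s≤s i<m) =
    window⁻ (f ∘ suc) j m l i j≤i i<m
  window⁻ {suc r} f zero    (suc zero)    l       i       _         (s≤s ())

  -- `AllPairs` is used because cards adjacent in a stack need not be adjacent in the interleaving.
  AllPairs-interleaving : ∀ {as bs cs} → Interleaving as bs cs → AllPairs R cs → AllPairs R as × AllPairs R bs
  AllPairs-interleaving []         []        = [] , []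
  AllPairs-interleaving (consˡ il) (px ∷ ps) =
    let pa , pb = AllPairs-interleaving il ps in
    All.tabulate (λ x∈ → All.lookup px (Perm.∈-resp-↭ (↭-sym (toPermutation il)) (∈-++⁺ˡ x∈))) ∷ pa , pb
  AllPairs-interleaving {as} (consʳ il) (px ∷ ps) =
    let pa , pb = AllPairs-interleaving il ps in
    pa , All.tabulate (λ x∈ → All.lookup px (Perm.∈-resp-↭ (↭-sym (toPermutation il)) (∈-++⁺ʳ as x∈))) ∷ pb

last-drop-tabulate : ∀ {A : Set} {r} (f : Fin (suc r) → A) {m} → m ≤ r → last (drop m (List.tabulate f)) ≡ just (f (fromℕ r))
last-drop-tabulate {r = zero}  f {zero}  z≤n       = refl
last-drop-tabulate {r = suc r} f {zero}  z≤n       = last-drop-tabulate (f ∘ suc) z≤n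
last-drop-tabulate {r = suc r} f {suc m} (s≤s m≤r) = last-drop-tabulate (f ∘ suc) m≤r

unique∧set⇒↭ : ∀ {A : Set} {xs ys : List A} → Unique xs → Unique ys →
  (∀ {x} → x ∈ xs → x ∈ ys) → (∀ {x} → x ∈ ys → x ∈ xs) → xs ↭ ys
unique∧set⇒↭ ux uy xs⊆ys ys⊆xs = ∼bag⇒↭ (unique∧set⇒bag ux uy (mk⇔ xs⊆ys ys⊆xs))

merge-interleaving : ∀ {N} (as bs : List (Fin N)) → Interleaving as bs (merge Fin._≤?_ as bs)
merge-interleaving []       bs = right bs
  where
  right : ∀ bs → Interleaving [] bs bs
  right []       = []
  right (b ∷ bs) = consʳ (right bs)
merge-interleaving (a ∷ as) [] = left (a ∷ as)
  where
  left : ∀ as → Interleaving as [] as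
  left []       = []
  left (a ∷ as) = consˡ (left as)
merge-interleaving (a ∷ as) (b ∷ bs) with does (a Fin.≤? b) | merge-interleaving as (b ∷ bs) | merge-interleaving (a ∷ as) bs
... | true  | il | _  = consˡ il
... | false | _  | il = consʳ il

module _ {r} (w : Permutation′ (suc r)) where
  private
    N = suc r
    pos : Fin N → Fin N
    pos = w ⟨$⟩ˡ_

  -- `pos` sends a label to its position in `deckOf w`, so this says that the deck keeps the
  -- relative order of the stack.
  InOrder : Deck N → Set
  InOrder = Linked (Fin._≤_ on pos)

  map-pos-deckOf : map pos (deckOf w) ≡ allFin N
  map-pos-deckOf = trans (List.map-tabulate (w ⟨$⟩ʳ_) pos) (List.tabulate-cong {g = id} λ i → inverseˡ w)

  interleaving⇒inOrder : ∀ {s₁ s₂} → Interleaving s₁ s₂ (deckOf w) → InOrder s₁ × InOrder s₂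
  interleaving⇒inOrder il = let p₁ , p₂ = AllPairs-interleaving il (AllPairs.tabulate⁺-< increasing) in
    Linked.AllPairs⇒Linked p₁ , Linked.AllPairs⇒Linked p₂
    where
    increasing : ∀ {i j} → i Fin.< j → pos (w ⟨$⟩ʳ i) Fin.≤ pos (w ⟨$⟩ʳ j)
    increasing {i} {j} i<j = subst₂ Fin._≤_ (sym (inverseˡ w)) (sym (inverseˡ w)) (ℕ.<⇒≤ i<j)

  -- Replacing labels by positions makes both stacks sorted and turns the deck into 0, 1, ..., N -
  -- 1. The merge of the stacks is a sorted permutation of that list, hence equal to it, and
  -- injectivity of `pos` carries the interleaving back to labels.
  inOrder⇒interleaving : ∀ {s₁ s₂} → s₁ ++ s₂ ↭ allFin N → InOrder s₁ → InOrder s₂ →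
    Interleaving s₁ s₂ (deckOf w)
  inOrder⇒interleaving {s₁} {s₂} s↭ o₁ o₂ = Interleaving.map pos-injective pos-injective
    (Interleaving.map⁻ pos pos pos (subst (Interleaving (map pos s₁) (map pos s₂)) merged≡ (merge-interleaving (map pos s₁) (map pos s₂))))
    where
    pos-injective : ∀ {x y} → pos x ≡ pos y → x ≡ y
    pos-injective eq = trans (sym (inverseʳ w)) (trans (cong (w ⟨$⟩ʳ_) eq) (inverseʳ w))
    merged = merge Fin._≤?_ (map pos s₁) (map pos s₂)
    map-pos-allFin : map pos (allFin N) ↭ allFin N
    map-pos-allFin = unique∧set⇒↭ (Unique.map⁺ pos-injective (Unique.allFin⁺ N)) (Unique.allFin⁺ N)
      (λ _ → ∈-allFin _)
      (λ {x} _ → subst (_∈ map pos (allFin N)) (inverseˡ w) (∈-map⁺ pos (∈-allFin (w ⟨$⟩ʳ x))))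
    merged↭ : merged ↭ allFin N
    merged↭ = ↭-trans (toPermutation (merge-interleaving (map pos s₁) (map pos s₂)))
      (subst (_↭ allFin N) (List.map-++ pos s₁ s₂) (↭-trans (Perm.map⁺ pos s↭) map-pos-allFin))
    merged≡ : merged ≡ map pos (deckOf w)
    merged≡ = trans (Pointwise-≡⇒≡ (Sorted.↗↭↗⇒≋ (Fin.≤-totalOrder N)
        (Sorted.merge⁺ (Fin.≤-decTotalOrder N) (Linked.map⁺ o₁) (Linked.map⁺ o₂))
        (Linked.AllPairs⇒Linked (AllPairs.tabulate⁺-< ℕ.<⇒≤))
        (↭⇒↭ₛ merged↭)))
      (sym map-pos-deckOf)

  -- Every element of Cdes (flip w) is an inequality that is strict for the
  -- vector with j entries 1 and j entries -1: the affine one if j = 0, and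
  -- those at the positions where the entries change if j ≥ 1.
  DescentsAt : ℕ → Set
  DescentsAt j =
    (∀ i → suc (toℕ i) ≢ j → suc (toℕ i) ≢ N ∸ j → pos (inject₁ i) Fin.≤ pos (suc i)) ×
    (1 ≤ j → pos (fromℕ r) Fin.≤ pos zero)

  module _ (j : ℕ) (2j≤N : j + j ≤ N) where
    private
      m = N ∸ j
      j≤m : j ≤ m
      j≤m = 2j≤N⇒j≤N∸j 2j≤N
      s₁ s₂ : Deck N
      s₁ = proj₁ (cut j (allFin N))
      s₂ = proj₂ (cut j (allFin N))
      take-all : take N (allFin N) ≡ allFin N
      take-all = List.take-all N (allFin N) (ℕ.≤-reflexive (List.length-tabulate {n = N} id))
      R = Fin._≤_ on pos

    descentsAt⇒inOrder : DescentsAt j → InOrder s₁ × InOrder s₂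
    descentsAt⇒inOrder (asc , wrap) =
        window⁺ id j m (λ i j≤i i<m → asc i (λ eq → ℕ.<-irrefl (sym eq) (s≤s j≤i)) (λ eq → ℕ.<-irrefl eq i<m))
      , Linked.++⁺
          (subst (λ xs → InOrder (drop m xs)) take-all (window⁺ id m N λ i m≤i _ →
            asc i (λ eq → ℕ.<-irrefl (sym eq) (s≤s (ℕ.≤-trans j≤m m≤i))) (λ eq → ℕ.<-irrefl (sym eq) (s≤s m≤i))))
          (connect j wrap)
          (window⁺ id 0 j λ i _ i<j → asc i (λ eq → ℕ.<-irrefl eq i<j) (λ eq → ℕ.<-irrefl eq (ℕ.<-≤-trans i<j j≤m)))
      where
      connect : ∀ j → (1 ≤ j → R (fromℕ r) zero) → Connected R (last (drop (N ∸ j) (allFin N))) (head (take j (allFin N)))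
      -- For `j = 0` the upper cards of the move form an empty block, so nothing is to be compared,
      -- whatever `last` returns.
      connect zero    _    with last (drop N (allFin N))
      ... | just _  = just-nothing
      ... | Maybe.nothing = nothing
      connect (suc j) wrap =
        subst (λ l → Connected R l (just zero)) (sym (last-drop-tabulate id (ℕ.m∸n≤m r j))) (just (wrap (s≤s z≤n)))

    inOrder⇒descentsAt : InOrder s₁ → InOrder s₂ → DescentsAt j
    inOrder⇒descentsAt o₁ o₂ = asc , λ 1≤j → wrap j 1≤j (proj₁ (proj₂ split))
      where
      split = Linked-++⁻ (drop m (allFin N)) o₂
      asc : ∀ i → suc (toℕ i) ≢ j → suc (toℕ i) ≢ m → R (inject₁ i) (suc i)
      -- A pair of neighbouring labels that straddles neither cut lies inside one of the three
      -- windows.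
      asc i i≢j i≢m with ℕ.<-cmp (suc (toℕ i)) j | ℕ.<-cmp (suc (toℕ i)) m
      ... | tri≈ _ i≡j _ | _            = contradiction i≡j i≢j
      ... | _            | tri≈ _ i≡m _ = contradiction i≡m i≢m
      ... | tri< i<j _ _ | _            = window⁻ id 0 j (proj₂ (proj₂ split)) i z≤n i<j
      ... | tri> _ _ j<i | tri< i<m _ _ = window⁻ id j m o₁ i (ℕ.s≤s⁻¹ j<i) i<m
      ... | _            | tri> _ _ m<i =
          window⁻ id m N (subst (λ xs → InOrder (drop m xs)) (sym take-all) (proj₁ split))
                                            i (ℕ.s≤s⁻¹ m<i) (s≤s (Fin.toℕ<n i))
      wrap : ∀ j → 1 ≤ j → Connected R (last (drop (N ∸ j) (allFin N))) (head (take j (allFin N))) → R (fromℕ r) zero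
      wrap (suc j) _ c with just p ← subst (λ l → Connected R l (just zero)) (last-drop-tabulate id (ℕ.m∸n≤m r j)) c =
        p

    riffle⇒descentsAt : deckOf w ∈ riffles j → DescentsAt j
    riffle⇒descentsAt d∈ =
      let o₁ , o₂ = interleaving⇒inOrder (∈-interleavings⁻ s₁ s₂ d∈) in inOrder⇒descentsAt o₁ o₂

    descentsAt⇒riffle : DescentsAt j → deckOf w ∈ riffles j
    descentsAt⇒riffle g = let o₁ , o₂ = descentsAt⇒inOrder g in
      ∈-interleavings⁺ s₁ s₂ (inOrder⇒interleaving (cut-↭ j 2j≤N (allFin N)) o₁ o₂)

-- Counting lattice points

Tight : ∀ {N} → ℕ → Vec ℤ N → Fin N → Set
Tight k t zero      = ⟨ θ , t ⟩ ≡ + k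
Tight k t i@(suc _) = ⟨ α i , t ⟩ ≡ 0ℤ

tight? : ∀ {N} k (t : Vec ℤ N) → Decidable (Tight k t)
tight? k t zero      = ⟨ θ , t ⟩ ℤ.≟ + k
tight? k t i@(suc _) = ⟨ α i , t ⟩ ℤ.≟ 0ℤ

-- The walls containing `t`: the only candidate for a set `I` making `t` admissible.
tightSet : ∀ {N} → ℕ → Vec ℤ N → Subset N
tightSet k t = Vec.tabulate (does ∘ tight? k t)

condition⇒tight : ∀ {N} {k I} {t : Vec ℤ N} {i} → Condition k I t i → i ∈ₛ I → Tight k t i
condition⇒tight {i = zero}  = proj₁
condition⇒tight {i = suc _} = proj₁

tight⇒∈ : ∀ {N} {k I} {t : Vec ℤ N} {i} → Condition k I t i → Tight k t i → i ∈ₛ I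
tight⇒∈ {I = I} {i = zero}  (_ , <) tight with zero Subset.∈? I
... | yes i∈I = i∈I
... | no  i∉I = contradiction tight (ℤ.<⇒≢ (< i∉I))
tight⇒∈ {I = I} {i = i@(suc _)} (_ , <) tight with i Subset.∈? I
... | yes i∈I = i∈I
... | no  i∉I = contradiction (sym tight) (ℤ.<⇒≢ (< i∉I))

-- Membership in `I` demands an equality that non-membership excludes by strictness, so `I` can be
-- read off from `t`. Distinct `I` therefore count disjoint sets of points.
admissible-injective : ∀ {N k I J} {t : Vec ℤ N} → Admissible k I t → Admissible k J t → I ≡ J
admissible-injective {k = k} {t = t} (_ , condI) (_ , condJ) = Subset.⊆-antisym
  (λ {i} i∈I → tight⇒∈ {k = k} {t = t} (condJ i) (condition⇒tight {k = k} {t = t} (condI i) i∈I))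
  (λ {i} i∈J → tight⇒∈ {k = k} {t = t} (condI i) (condition⇒tight {k = k} {t = t} (condJ i) i∈J))

tightSet-admissible : ∀ {r} k (t : Vec ℤ (suc r)) → sumᵛ t ≡ 0ℤ → ⟨ θ , t ⟩ ℤ.≤ + k →
  (∀ i → 0ℤ ℤ.≤ ⟨ α (suc i) , t ⟩) → Admissible k (tightSet k t) t
tightSet-admissible k t sum≡0 θ≤k 0≤α = sum≡0 , cond
  where
  cond : ∀ i → Condition k (tightSet k t) t i
  cond zero    = ∈-tabulate⁻ (tight? k t) , λ ∉ → ℤ.≤∧≢⇒< θ≤k (∉ ∘ ∈-tabulate⁺ (tight? k t))
  cond (suc i) = ∈-tabulate⁻ (tight? k t) , λ ∉ → ℤ.≤∧≢⇒< (0≤α i) (∉ ∘ ∈-tabulate⁺ (tight? k t) ∘ sym)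

module _ {r k I} {t : Vec ℤ (suc r)} (adm : Admissible k I t) where

  admissible⇒decreasing : Decreasing t
  admissible⇒decreasing i = ℤ.0≤i-j⇒j≤i (subst (0ℤ ℤ.≤_) (⟨e-e,⟩ (inject₁ i) (suc i) t) nonneg)
    where
    nonneg : 0ℤ ℤ.≤ ⟨ α (suc i) , t ⟩
    nonneg with suc i Subset.∈? I
    ... | yes i∈I = ℤ.≤-reflexive (sym (proj₁ (proj₂ adm (suc i)) i∈I))
    ... | no  i∉I = ℤ.<⇒≤ (proj₂ (proj₂ adm (suc i)) i∉I)

  admissible⇒spread : lookup t zero ℤ.- lookup t (fromℕ r) ℤ.≤ + k
  admissible⇒spread = subst (ℤ._≤ + k) (⟨e-e,⟩ zero (fromℕ r) t) bound
    where
    bound : ⟨ θ , t ⟩ ℤ.≤ + k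
    bound with zero Subset.∈? I
    ... | yes 0∈I = ℤ.≤-reflexive (proj₁ (proj₂ adm zero) 0∈I)
    ... | no  0∉I = ℤ.<⇒≤ (proj₂ (proj₂ adm zero) 0∉I)

-- The two thresholds contribute separately: each bracket is 1 where its own indicator drops and 0
-- elsewhere.
⟨α,step⟩ : ∀ {r} p q (i : Fin r) → ⟨ α (suc i) , step (suc r) p q ⟩ ≡
  (𝟙[ toℕ i < p ] ℤ.- 𝟙[ suc (toℕ i) < p ]) ℤ.+ (𝟙[ toℕ i < q ] ℤ.- 𝟙[ suc (toℕ i) < q ])
⟨α,step⟩ {r} p q i = begin
  ⟨ α (suc i) , t ⟩
    ≡⟨ ⟨e-e,⟩ (inject₁ i) (suc i) t ⟩
  lookup t (inject₁ i) ℤ.- lookup t (suc i)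
    ≡⟨ cong₂ ℤ._-_ (lookup-step p q (inject₁ i)) (lookup-step p q (suc i)) ⟩
  value (toℕ (inject₁ i)) ℤ.- value (suc (toℕ i))
    ≡⟨ cong (λ n → value n ℤ.- value (suc (toℕ i))) (Fin.toℕ-inject₁ i) ⟩
  value (toℕ i) ℤ.- value (suc (toℕ i))
    ≡⟨ regroup 𝟙[ toℕ i < p ] 𝟙[ toℕ i < q ] 𝟙[ suc (toℕ i) < p ] 𝟙[ suc (toℕ i) < q ] ⟩
  (𝟙[ toℕ i < p ] ℤ.- 𝟙[ suc (toℕ i) < p ]) ℤ.+ (𝟙[ toℕ i < q ] ℤ.- 𝟙[ suc (toℕ i) < q ]) ∎
  where
  open ≡-Reasoning
  t = step (suc r) p q
  value : ℕ → ℤ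
  value n = 𝟙[ n < p ] ℤ.+ 𝟙[ n < q ] ℤ.- 1ℤ
  regroup : ∀ a b c d → (a ℤ.+ b ℤ.- 1ℤ) ℤ.- (c ℤ.+ d ℤ.- 1ℤ) ≡ (a ℤ.- c) ℤ.+ (b ℤ.- d)
  regroup = ℤ-Solver.solve-∀

𝟙-drop : ∀ i p → 0ℤ ℤ.≤ 𝟙[ i < p ] ℤ.- 𝟙[ suc i < p ]
𝟙-drop i p = ℤ.i≤j⇒0≤j-i (𝟙-antitone i p)

𝟙-drop-at : ∀ i {p} → suc i ≡ p → 𝟙[ i < p ] ℤ.- 𝟙[ suc i < p ] ≡ 1ℤ
𝟙-drop-at i refl = cong₂ ℤ._-_ (𝟙-< (ℕ.n<1+n i)) (𝟙-≥ (ℕ.≤-refl {suc i}))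

𝟙-drop-const : ∀ i {p} → suc i ≢ p → 𝟙[ i < p ] ℤ.- 𝟙[ suc i < p ] ≡ 0ℤ
𝟙-drop-const i {p} neq = ℤ.i≡j⇒i-j≡0 (sym (𝟙-const i p neq))

⟨α,step⟩-nonneg : ∀ {r} p q (i : Fin r) → 0ℤ ℤ.≤ ⟨ α (suc i) , step (suc r) p q ⟩
⟨α,step⟩-nonneg p q i =
  subst (0ℤ ℤ.≤_) (sym (⟨α,step⟩ p q i)) (ℤ.+-mono-≤ (𝟙-drop (toℕ i) p) (𝟙-drop (toℕ i) q))

⟨α,step⟩-zero : ∀ {r} {p q} {i : Fin r} → suc (toℕ i) ≢ p → suc (toℕ i) ≢ q → ⟨ α (suc i) , step (suc r) p q ⟩ ≡ 0ℤ
⟨α,step⟩-zero {p = p} {q} {i} i≢p i≢q =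
  trans (⟨α,step⟩ p q i) (cong₂ ℤ._+_ (𝟙-drop-const (toℕ i) i≢p) (𝟙-drop-const (toℕ i) i≢q))

-- Both brackets are nonnegative, so they cannot cancel; this covers p = q, where the two drops
-- coincide and the entry jumps by 2.
⟨α,step⟩-zero⁻ : ∀ {r} {p q} {i : Fin r} → ⟨ α (suc i) , step (suc r) p q ⟩ ≡ 0ℤ → suc (toℕ i) ≢ p × suc (toℕ i) ≢ q
⟨α,step⟩-zero⁻ {p = p} {q} {i} ≡0 =
    (λ i≡p → ℤ.<⇒≢ (ℤ.+-mono-<-≤ (pos i≡p) (𝟙-drop (toℕ i) q)) 0≡)
  , (λ i≡q → ℤ.<⇒≢ (ℤ.+-mono-≤-< (𝟙-drop (toℕ i) p) (pos i≡q)) 0≡)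
  where
  0≡ : 0ℤ ≡ (𝟙[ toℕ i < p ] ℤ.- 𝟙[ suc (toℕ i) < p ]) ℤ.+ (𝟙[ toℕ i < q ] ℤ.- 𝟙[ suc (toℕ i) < q ])
  0≡ = trans (sym ≡0) (⟨α,step⟩ p q i)
  pos : ∀ {p} → suc (toℕ i) ≡ p → 0ℤ ℤ.< 𝟙[ toℕ i < p ] ℤ.- 𝟙[ suc (toℕ i) < p ]
  pos i≡p = subst (0ℤ ℤ.<_) (sym (𝟙-drop-at (toℕ i) i≡p)) (ℤ.+<+ (s≤s z≤n))

⟨θ,step⟩ : ∀ {r} p q → ⟨ θ , step (suc r) p q ⟩ ≡
  (𝟙[ 0 < p ] ℤ.+ 𝟙[ 0 < q ]) ℤ.- (𝟙[ r < p ] ℤ.+ 𝟙[ r < q ])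
⟨θ,step⟩ {r} p q = begin
  ⟨ θ , t ⟩                                                   ≡⟨ ⟨e-e,⟩ zero (fromℕ r) t ⟩
  lookup t zero ℤ.- lookup t (fromℕ r)
    ≡⟨ cong₂ ℤ._-_ (lookup-step {suc r} p q zero) (lookup-step p q (fromℕ r)) ⟩
  value 0 ℤ.- value (toℕ (fromℕ r))
    ≡⟨ cong (λ n → value 0 ℤ.- value n) (Fin.toℕ-fromℕ r) ⟩
  value 0 ℤ.- value r
    ≡⟨ regroup 𝟙[ 0 < p ] 𝟙[ 0 < q ] 𝟙[ r < p ] 𝟙[ r < q ] ⟩
  (𝟙[ 0 < p ] ℤ.+ 𝟙[ 0 < q ]) ℤ.- (𝟙[ r < p ] ℤ.+ 𝟙[ r < q ]) ∎
  where
  open ≡-Reasoning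
  t = step (suc r) p q
  value : ℕ → ℤ
  value n = 𝟙[ n < p ] ℤ.+ 𝟙[ n < q ] ℤ.- 1ℤ
  regroup : ∀ a b c d → (a ℤ.+ b ℤ.- 1ℤ) ℤ.- (c ℤ.+ d ℤ.- 1ℤ) ≡ (a ℤ.+ b) ℤ.- (c ℤ.+ d)
  regroup = ℤ-Solver.solve-∀

⟨θ,step⟩-≤2 : ∀ {r} p q → ⟨ θ , step (suc r) p q ⟩ ℤ.≤ + 2
⟨θ,step⟩-≤2 {r} p q = subst (ℤ._≤ + 2) (sym (⟨θ,step⟩ p q))
  (ℤ.+-mono-≤ (ℤ.+-mono-≤ (proj₂ (𝟙-bounds 0 p)) (proj₂ (𝟙-bounds 0 q)))
              (ℤ.neg-mono-≤ (ℤ.+-mono-≤ (proj₁ (𝟙-bounds r p)) (proj₁ (𝟙-bounds r q)))))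

-- (1, …, 1, 0, …, 0, -1, …, -1), with j entries 1 and j entries -1.
point : ∀ {r} → ℕ → Vec ℤ (suc r)
point {r} j = step (suc r) j (suc r ∸ j)

module _ {r} {j} (2j≤N : j + j ≤ suc r) where
  private
    N = suc r
    j≤N : j ≤ N
    j≤N = ℕ.≤-trans (ℕ.m≤m+n j j) 2j≤N

  sum-point : sumᵛ (point {r} j) ≡ 0ℤ
  sum-point = trans (sum-step N j≤N (ℕ.m∸n≤m N j)) (trans (cong (λ n → + n ℤ.- + N) (ℕ.m+[n∸m]≡n j≤N)) (ℤ.+-inverseʳ (+ N)))

  ⟨θ,point⟩≡2 : 1 ≤ j → ⟨ θ , point {r} j ⟩ ≡ + 2
  ⟨θ,point⟩≡2 1≤j = trans (⟨θ,step⟩ {r} j (N ∸ j))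
    (cong₂ ℤ._-_ (cong₂ ℤ._+_ (𝟙-< 1≤j) (𝟙-< (ℕ.≤-trans 1≤j j≤m)))
                 (cong₂ ℤ._+_ (𝟙-≥ (ℕ.≤-trans j≤m m≤r)) (𝟙-≥ m≤r)))
    where
    j≤m : j ≤ N ∸ j
    j≤m = 2j≤N⇒j≤N∸j 2j≤N
    m≤r : N ∸ j ≤ r
    m≤r = ℕ.∸-monoʳ-≤ N 1≤j

⟨θ,point⟩≡2⁻ : ∀ {r} j → ⟨ θ , point {r} j ⟩ ≡ + 2 → 1 ≤ j
⟨θ,point⟩≡2⁻     (suc _) _   = s≤s z≤n
-- For `j = 0` the point is the origin, on which θ takes the value 0.
⟨θ,point⟩≡2⁻ {r} zero    θ≡2 = contradiction
  (trans (sym θ≡2) (trans (⟨θ,step⟩ {r} 0 (suc r)) (cong (λ z → 1ℤ ℤ.- (0ℤ ℤ.+ z)) (𝟙-< (ℕ.n<1+n r))))) λ ()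

-- The coordinate with index `i` tells them apart: it is 1 in `point j`, since i < j ≤ N - j, and at
-- most 0 in `point i`.
point-distinct : ∀ {r i j} → i ℕ.< j → j + j ≤ suc r → point {r} i ≢ point j
point-distinct {r} {i} {j} i<j 2j≤N eq = contradiction 1≤0 λ { (ℤ.+≤+ ()) }
  where
  N = suc r
  i<m : i ℕ.< N ∸ j
  i<m = ℕ.<-≤-trans i<j (2j≤N⇒j≤N∸j 2j≤N)
  k : Fin N
  k = fromℕ< (ℕ.<-≤-trans i<m (ℕ.m∸n≤m N j))
  at-k : ∀ l → lookup (point {r} l) k ≡ 𝟙[ i < l ] ℤ.+ 𝟙[ i < N ∸ l ] ℤ.- 1ℤ
  at-k l =
    trans (lookup-step l (N ∸ l) k) (cong (λ n → 𝟙[ n < l ] ℤ.+ 𝟙[ n < N ∸ l ] ℤ.- 1ℤ) (Fin.toℕ-fromℕ< _))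
  1≤0 : 1ℤ ℤ.≤ 0ℤ
  1≤0 = begin
    1ℤ                                   ≡⟨ cong₂ (λ y z → y ℤ.+ z ℤ.- 1ℤ) (𝟙-< i<j) (𝟙-< i<m) ⟨
    𝟙[ i < j ] ℤ.+ 𝟙[ i < N ∸ j ] ℤ.- 1ℤ ≡⟨ at-k j ⟨
    lookup (point {r} j) k               ≡⟨ cong (λ t → lookup t k) eq ⟨
    lookup (point {r} i) k               ≡⟨ at-k i ⟩
    𝟙[ i < i ] ℤ.+ 𝟙[ i < N ∸ i ] ℤ.- 1ℤ
      ≤⟨ ℤ.+-monoˡ-≤ (ℤ.- 1ℤ) (ℤ.+-mono-≤ (ℤ.≤-reflexive (𝟙-≥ (ℕ.≤-refl {i}))) (proj₂ (𝟙-bounds i (N ∸ i)))) ⟩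
    0ℤ                                   ∎
    where open ℤ.≤-Reasoning

point-injective : ∀ {r i j} → i + i ≤ suc r → j + j ≤ suc r → point {r} i ≡ point j → i ≡ j
point-injective {i = i} {j} 2i≤N 2j≤N eq with ℕ.<-cmp i j
... | tri< i<j _ _ = contradiction eq (point-distinct i<j 2j≤N)
... | tri≈ _ i≡j _ = i≡j
... | tri> _ _ j<i = contradiction (sym eq) (point-distinct j<i 2i≤N)

-- Matching lattice points with cuts that can produce the deck

subsets-unique : ∀ N → Unique (subsets N)
subsets-unique zero    = [] ∷ []
subsets-unique (suc N) = Unique.cartesianProductWith⁺ _∷_ Vec.∷-injective
  (((λ ()) ∷ []) ∷ [] ∷ []) (subsets-unique N)

∈-subsets : ∀ {N} (I : Subset N) → I ∈ subsets N
∈-subsets []            = here refl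
∈-subsets (inside  ∷ I) = ∈-cartesianProductWith⁺ _∷_ {xs = inside ∷ outside ∷ []} (here refl) (∈-subsets I)
∈-subsets (outside ∷ I) =
  ∈-cartesianProductWith⁺ _∷_ {xs = inside ∷ outside ∷ []} (there (here refl)) (∈-subsets I)

-- Injectivity is asked only on the list because `point` is not injective outright: `j` and N - j
-- give the same vector when j ≤ N.
map-unique : ∀ {A B : Set} {f : A → B} {xs} → (∀ {x y} → x ∈ xs → y ∈ xs → f x ≡ f y → x ≡ y) →
  Unique xs → Unique (map f xs)
map-unique inj []       = []
map-unique inj (x∉ ∷ u) =
  All.map⁺ (All.tabulate λ y∈ fx≡fy → All.lookup x∉ y∈ (inj (here refl) (there y∈) fx≡fy)) ∷
  map-unique (λ x∈ y∈ → inj (there x∈) (there y∈)) u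

sum-length : ∀ {A : Set} (xss : List (List A)) → sum (map length xss) ≡ length (concat xss)
sum-length []         = refl
sum-length (xs ∷ xss) = trans (cong (length xs ℕ.+_) (sum-length xss)) (sym (List.length-++ xs))

module _ {r} (w : Permutation′ (suc r)) where
  private
    N = suc r
    v = flip w
    d = deckOf w
    open DecMembership (_≟ᴰ_ {N}) using (_∈?_)

    faces : List (Subset N)
    faces = filter (Subset._⊆? ∁ (Cdes v)) (subsets N)

    points : Subset N → List (Vec ℤ N)
    points I = filter (admissible? 2 I) (box 2 N)

    latticePoints : List (Vec ℤ N)
    latticePoints = concat (map points faces)

    levels : List ℕ
    levels = filter (λ j → d ∈? riffles j) (upTo (suc ⌊ N /2⌋))

    level⁻ : ∀ {j} → j ∈ levels → j + j ≤ N × d ∈ riffles j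
    level⁻ j∈ = let j∈ , d∈ = ∈-filter⁻ (λ j → d ∈? riffles j) j∈ in j≤N/2⇒2j≤N (ℕ.s≤s⁻¹ (∈-upTo⁻ j∈)) , d∈

  -- The two stacks of a cut are disjoint, so no interleaving is listed twice and each `j`
  -- contributes 0 or 1.
  sum-count-riffles : ∀ js → All (λ j → j + j ≤ N) js →
    sum (map (λ j → count d (riffles j)) js) ≡ length (filter (λ j → d ∈? riffles j) js)
  sum-count-riffles []       []       = refl
  sum-count-riffles (j ∷ js) (p ∷ ps) with d ∈? riffles j
  ... | yes d∈ = cong₂ ℕ._+_
          (count-∈ (interleavings-unique _ _ (cut-disjoint j p (allFin N) (Unique.allFin⁺ N))) d∈)
          (sum-count-riffles js ps)
  ... | no  d∉ = cong₂ ℕ._+_ (count-∉ d∉) (sum-count-riffles js ps)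

  private
    latticePoints-unique : Unique latticePoints
    latticePoints-unique = Unique.concat⁺
      (All.map⁺ (All.tabulate λ {I} _ → Unique.filter⁺ (admissible? 2 I) (box-unique 2 N)))
      (AllPairs.map⁺ (AllPairs.map disjoint (Unique.filter⁺ (Subset._⊆? ∁ (Cdes v)) (subsets-unique N))))
      where
      disjoint : ∀ {I J} → I ≢ J → Disjoint (points I) (points J)
      disjoint {I} {J} I≢J (p , q) = I≢J (admissible-injective {k = 2}
        (proj₂ (∈-filter⁻ (admissible? 2 I) {xs = box 2 N} p)) (proj₂ (∈-filter⁻ (admissible? 2 J) {xs = box 2 N} q)))

    points-unique : Unique (map (point {r}) levels)
    points-unique = map-unique
      (λ i∈ j∈ → point-injective (proj₁ (level⁻ i∈)) (proj₁ (level⁻ j∈)))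
      (Unique.filter⁺ (λ j → d ∈? riffles j) (Unique.upTo⁺ _))

    -- Admissibility puts every wall through the point into `I`, which avoids `Cdes v`; a descent
    -- there would be a contradiction.
    admissible-point⇒descentsAt : ∀ {I j} → I ⊆ ∁ (Cdes v) → j + j ≤ N → Admissible 2 I (point j) → DescentsAt w j
    admissible-point⇒descentsAt {I} {j} I⊆ 2j≤N (_ , cond) =
        (λ i i≢j i≢m → ℕ.≮⇒≥ λ desc → Subset.x∈∁p⇒x∉p
          (I⊆ (tight⇒∈ {k = 2} {t = point j} (cond (suc i)) (⟨α,step⟩-zero {r} {j} {N ∸ j} i≢j i≢m))) (suc∈Cdes⁺ v desc))
      , (λ 1≤j → ℕ.≮⇒≥ λ desc → Subset.x∈∁p⇒x∉p
          (I⊆ (tight⇒∈ {k = 2} {t = point j} (cond zero) (⟨θ,point⟩≡2 {r} {j} 2j≤N 1≤j))) (zero∈Cdes⁺ v desc))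

    -- A simple wall through the point is one where its entries do not change, and the affine wall
    -- contains it only for j ≥ 1; at these indices `DescentsAt` forbids descents.
    descentsAt⇒tightSet⊆ : ∀ {j} → j + j ≤ N → DescentsAt w j → tightSet 2 (point j) ⊆ ∁ (Cdes v)
    descentsAt⇒tightSet⊆ {j} 2j≤N (asc , wrap) {zero}  i∈ = Subset.x∉p⇒x∈∁p λ c →
      ℕ.<⇒≱ (zero∈Cdes⁻ v c) (wrap (⟨θ,point⟩≡2⁻ {r} j (∈-tabulate⁻ (tight? 2 (point j)) i∈)))
    descentsAt⇒tightSet⊆ {j} 2j≤N (asc , wrap) {suc i} i∈ = Subset.x∉p⇒x∈∁p λ c →
      let i≢j , i≢m = ⟨α,step⟩-zero⁻ {r} {j} {N ∸ j} (∈-tabulate⁻ (tight? 2 (point j)) i∈)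
      in ℕ.<⇒≱ (suc∈Cdes⁻ v c) (asc i i≢j i≢m)

    ∈-levels : ∀ {I} j → I ⊆ ∁ (Cdes v) → j + j ≤ N → Admissible 2 I (point j) → j ∈ levels
    ∈-levels j I⊆ 2j≤N adm = ∈-filter⁺ (λ j → d ∈? riffles j) (∈-upTo⁺ (s≤s (2j≤N⇒j≤N/2 2j≤N)))
      (descentsAt⇒riffle w j 2j≤N (admissible-point⇒descentsAt I⊆ 2j≤N adm))

    face-point⇒point : ∀ {I t} → I ⊆ ∁ (Cdes v) → Admissible 2 I t → t ∈ map point levels
    face-point⇒point {I} {t} I⊆ adm
      with classification t (admissible⇒decreasing {k = 2} adm) (proj₁ adm) (admissible⇒spread {k = 2} adm)
    ... | j , 2j≤N , refl = ∈-map⁺ (point {r}) {x = j} (∈-levels j I⊆ 2j≤N adm)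

    latticePoint⇒point : ∀ {t} → t ∈ latticePoints → t ∈ map point levels
    latticePoint⇒point {t} t∈ =
      let ts , t∈ts , ts∈ = ∈-concat⁻′ (map points faces) t∈
          I , I∈ , ts≡    = ∈-map⁻ points ts∈
      in face-point⇒point
           (proj₂ (∈-filter⁻ (Subset._⊆? ∁ (Cdes v)) {xs = subsets N} I∈))
           (proj₂ (∈-filter⁻ (admissible? 2 I) {xs = box 2 N} (subst (t ∈_) ts≡ t∈ts)))

    point⇒latticePoint : ∀ {t} → t ∈ map point levels → t ∈ latticePoints
    point⇒latticePoint t∈ with j , j∈ , refl ← ∈-map⁻ point t∈ =
      let 2j≤N , d∈ = level⁻ j∈
          -- The face is forced: a point is admissible only for the set of walls through it.
          I         = tightSet 2 (point {r} j)
          adm       =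
            tightSet-admissible 2 (point {r} j) (sum-point {r} {j} 2j≤N) (⟨θ,step⟩-≤2 {r} j (N ∸ j)) (⟨α,step⟩-nonneg {r} j (N ∸ j))
      in ∈-concat⁺′ (∈-filter⁺ (admissible? 2 I) (admissible⇒∈box 2 I (point j) adm) adm)
           (∈-map⁺ points (∈-filter⁺ (Subset._⊆? ∁ (Cdes v)) (∈-subsets I)
             (descentsAt⇒tightSet⊆ 2j≤N (riffle⇒descentsAt w j 2j≤N d∈))))

  sum-a≡sum-count : sum (map (a 2) faces) ≡
    sum (map (λ j → count d (riffles j)) (upTo (suc ⌊ N /2⌋)))
  sum-a≡sum-count = begin
    sum (map (a 2) faces)                                      ≡⟨ cong sum (List.map-∘ faces) ⟩
    sum (map length (map points faces))                        ≡⟨ sum-length (map points faces) ⟩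
    length latticePoints
      ≡⟨ Perm.↭-length (unique∧set⇒↭ latticePoints-unique points-unique latticePoint⇒point point⇒latticePoint) ⟩
    length (map point levels)                                  ≡⟨ List.length-map point levels ⟩
    length levels
      ≡⟨ sum-count-riffles (upTo (suc ⌊ N /2⌋)) (All.tabulate (j≤N/2⇒2j≤N ∘ ℕ.s≤s⁻¹ ∘ ∈-upTo⁻)) ⟨
    sum (map (λ j → count d (riffles j)) (upTo (suc ⌊ N /2⌋))) ∎
    where open ≡-Reasoning

  x₂⁻¹≡Prob-shuffle : invert (x 2) w ≡ Prob (shuffle N) d
  x₂⁻¹≡Prob-shuffle = begin
    invert (x 2) w                                                             ≡⟨⟩
    (+ sum (map (a 2) faces)) ℚ./ (2 ^ r)
      ≡⟨ cong (λ n → (+ n) ℚ./ (2 ^ r)) sum-a≡sum-count ⟩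
    (+ sum (map (λ j → count d (riffles j)) (upTo (suc ⌊ N /2⌋)))) ℚ./ (2 ^ r) ≡⟨ Prob-shuffle N d ⟨
    Prob (shuffle N) d                                                         ∎
    where
    open ≡-Reasoning
    instance _ = ℕ.m^n≢0 2 r

-- Both parities of the deck size and both forms of the dropping rule

Prob-dropCards-cut : ∀ {N} j (d : Deck N) → j + j ≤ N →
  Prob (dropCards (cut j (allFin N))) d ≡ Prob (interleaveUniformly (cut j (allFin N))) d
Prob-dropCards-cut {N} j d 2j≤N = Prob-dropCards-uniform d (cut-disjoint j 2j≤N (allFin N) (Unique.allFin⁺ N))

proposition7 : ∀ (n : ℕ) → 1 ≤ n →
    (∀ (w : Permutation′ (2 * n)) →
    invert (x 2) w ≡ Prob (shuffle (2 * n)) (deckOf w))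
    × (∀ (w : Permutation′ (suc (2 * n))) →
    invert (x 2) w ≡ Prob (shuffle (suc (2 * n))) (deckOf w))
    × (∀ (j : ℕ) → j ≤ n → ∀ (d : Deck (2 * n)) →
    Prob (dropCards (cut j (allFin (2 * n)))) d
    ≡ Prob (interleaveUniformly (cut j (allFin (2 * n)))) d)
    × (∀ (j : ℕ) → j ≤ n → ∀ (d : Deck (suc (2 * n))) →
    Prob (dropCards (cut j (allFin (suc (2 * n))))) d
    ≡ Prob (interleaveUniformly (cut j (allFin (suc (2 * n))))) d)
-- Matching `n` as a successor lets `2 * n` compute to a successor, the form of deck size that
-- `x₂⁻¹≡Prob-shuffle` expects.
proposition7 n@(suc _) 1≤n = (λ w → x₂⁻¹≡Prob-shuffle {ℕ.pred (2 * n)} w) , (λ w → x₂⁻¹≡Prob-shuffle {2 * n} w)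
  , (λ j j≤n d → Prob-dropCards-cut j d (2j≤2n j≤n))
  , (λ j j≤n d → Prob-dropCards-cut j d (ℕ.m≤n⇒m≤1+n (2j≤2n j≤n)))
  where
  2j≤2n : ∀ {j} → j ≤ n → j + j ≤ 2 * n
  2j≤2n {j} j≤n = subst (ℕ._≤ 2 * n) (cong (j ℕ.+_) (ℕ.+-identityʳ j)) (ℕ.*-monoʳ-≤ 2 j≤n)
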